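{- For every integer $m\geq 0$, $H(m,2)\leq\frac{83}{192}\,m\,2^{m-1}$.
   Context: A triangular choice multigraph (TCM) $\mathcal{G}$ on $[m]$ is obtained by choosing, for every 3-element subset $\{u,v,w\}\subseteq[m]$, exactly one of the pairs $uv,uw,vw$ and adding one copy of it as an edge. $m^{\mathcal{G}}_{xy}$ denotes the multiplicity of the pair $xy$. $w(\mathcal{G},2)=\sum_{xy\in\binom{[m]}{2}}2^{m^{\mathcal{G}}_{xy}}$, and $H(m,2)$ is the maximum of $w(\mathcal{G},2)$ over all TCMs on $[m]$. -}

module Defs where

open import Data.Nat using (ℕ; zero; suc; _+_; _*_; _^_; _<_; _≤_)
open import Data.Nat.Properties using (<-cmp)
open import Data.Fin using (Fin; toℕ)
open import Data.Fin.Patterns using (0F; 1F; 2F)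
open import Data.List using (List; map; allFin)
open import Data.Nat.ListAction using (sum)
open import Relation.Binary.Definitions using (Tri; tri<; tri≈; tri>)

-- A triangular choice multigraph on the vertex set [m] = Fin m.
-- For every 3-set {u,v,w}, listed increasingly as u < v < w, the TCM chooses
-- one of the three pairs, encoded as
--   0F ↦ uv ,  1F ↦ uw ,  2F ↦ vw .
TCM : ℕ → Set
TCM m = (u v w : Fin m) → toℕ u < toℕ v → toℕ v < toℕ w → Fin 3

private
  is : Fin 3 → Fin 3 → ℕ
  is 0F 0F = 1
  is 1F 1F = 1
  is 2F 2F = 1
  is _  _  = 0

  contrib : ∀ {m} → TCM m → (x y : Fin m) → toℕ x < toℕ y → Fin m → ℕ
  contrib c x y x<y z with <-cmp (toℕ z) (toℕ x)
  ... | tri< z<x _ _ = is (c z x y z<x x<y) 2F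
  ... | tri≈ _ _ _   = 0
  ... | tri> _ _ x<z with <-cmp (toℕ z) (toℕ y)
  ...   | tri< z<y _ _ = is (c x z y x<z z<y) 1F
  ...   | tri≈ _ _ _   = 0
  ...   | tri> _ _ y<z = is (c x y z x<y y<z) 0F

mult : ∀ {m} → TCM m → (x y : Fin m) → toℕ x < toℕ y → ℕ
mult {m} c x y x<y = sum (map (contrib c x y x<y) (allFin m))

private
  pairTerm : ∀ {m} → TCM m → Fin m → Fin m → ℕ
  pairTerm c x y with <-cmp (toℕ x) (toℕ y)
  ... | tri< x<y _ _ = 2 ^ mult c x y x<y
  ... | tri≈ _ _ _   = 0
  ... | tri> _ _ _   = 0

w2 : ∀ {m} → TCM m → ℕ
w2 {m} c = sum (map (λ x → sum (map (pairTerm c x) (allFin m))) (allFin m))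

{-# OPTIONS --safe #-}

-- Write d(xy) for the number of triples on xy that do not choose xy, so that
-- 2^mult(xy) = 2^(m-2) · 2^(-d(xy)).  Keeping every vertex independently with
-- probability 2/3 turns (1/4)^d on the random vertex set into (1/2)^d on [m], so it is
-- enough to show, for every induced TCM on n vertices and q = 1/4, that the sum of q^d(vx)
-- over ordered pairs is at most (83/72) n.
--
-- At a vertex v the edges form a tournament in which d(vx) bounds the number of losses of
-- vx, hence at most 2j+1 of them have d ≤ j.  Edges with d = 0 form a matching.  An edge
-- with d ≤ 2 between a matched and an unmatched vertex gives its whole weight to the
-- unmatched end; the other edges split theirs evenly.  After this redistribution every
-- vertex separately receives at most 83/72: a matched vertex has lost its edges with
-- d = 1, and at an unmatched vertex an edge with d = 1 to a matched vertex beats all the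
-- others, which pushes their deficits up.

module Submission where

open import Defs
open import Data.Nat using (ℕ; _*_; _^_; _≤_)

open import Data.Bool using (Bool; true; false; not; _∧_; if_then_else_; T)
import Data.Bool.Properties as Bool
open import Data.Fin using (Fin; zero; suc; _≟_; toℕ)
open import Data.Fin.Patterns using (0F; 1F; 2F)
open import Data.Fin.Properties using (any?; toℕ-injective)
open import Data.List using (map; allFin; tabulate)
open import Data.List.Properties using (map-tabulate)
open import Data.Nat using (zero; suc; _+_; _∸_; _⊔_; _<_; _≤ᵇ_; z≤n; s≤s; NonZero)
import Data.Nat.ListAction as List
open import Data.Nat.Properties hiding (_≟_)
import Data.Nat.Properties as ℕ
open import Data.Nat.Solver using (module +-*-Solver)
open import Data.Product using (∃; _×_; _,_; proj₁; proj₂)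
open import Data.Sum using (_⊎_; inj₁; inj₂)
open import Data.Vec.Functional using (_∷_)
open import Function using (_∘_; id)
open import Relation.Binary.Definitions using (Tri; tri<; tri≈; tri>)
open import Relation.Binary.PropositionalEquality
open import Relation.Nullary using (¬_; Dec; yes; no; does; contradiction)
open import Relation.Nullary.Decidable using (dec-true; dec-false; ¬?; _×-dec_)
open import Algebra.Properties.Semiring.Sum +-*-semiring
  using (sum; sum-cong-≗; ∑-distrib-+; ∑-comm; sum-replicate-zero; *-distribˡ-sum)
import Algebra.Properties.CommutativeMonoid.Sum *-1-commutativeMonoid as Product
open Product using ()
  renaming (sum to product; sum-cong-≗ to product-cong-≗; ∑-distrib-+ to product-distrib-*)

private variable
  m : ℕ

-- Sums over subsets of Fin m

Subset : ℕ → Set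
Subset m = Fin m → Bool

infix 4 _∈_
infixl 7 _∩_ _∖_

_∈_ : Fin m → Subset m → Set
x ∈ S = S x ≡ true

_∩_ : Subset m → Subset m → Subset m
(S ∩ T) x = S x ∧ T x

_∖_ : Subset m → Fin m → Subset m
(S ∖ w) x = S x ∧ not (does (x ≟ w))

∑∈ : Subset m → (Fin m → ℕ) → ℕ
∑∈ S f = sum (λ x → if S x then f x else 0)

card : Subset m → ℕ
card S = ∑∈ S (λ _ → 1)

∈-∩⁺ : (S T : Subset m) {x : Fin m} → x ∈ S → x ∈ T → x ∈ S ∩ T
∈-∩⁺ S T p q rewrite p | q = refl

∈-∩⁻ : (S T : Subset m) {x : Fin m} → x ∈ S ∩ T → x ∈ S × x ∈ T
∈-∩⁻ S T {x} p with S x | T x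
... | true | true = refl , refl

∈-∖⁺ : (S : Subset m) {x w : Fin m} → x ∈ S → x ≢ w → x ∈ S ∖ w
∈-∖⁺ S {x} {w} p q rewrite p | dec-false (x ≟ w) q = refl

∈-∖⁻ : (S : Subset m) {x w : Fin m} → x ∈ S ∖ w → x ∈ S × x ≢ w
∈-∖⁻ S {x} {w} p with S x | x ≟ w
... | true | no q = refl , q

sum-mono : {f g : Fin m → ℕ} → (∀ x → f x ≤ g x) → sum f ≤ sum g
sum-mono {zero}  f≤g = z≤n
sum-mono {suc m} f≤g = +-mono-≤ (f≤g zero) (sum-mono (f≤g ∘ suc))

sum-split : (w : Fin m) (f : Fin m → ℕ) → sum f ≡ f w + sum (λ x → if does (x ≟ w) then 0 else f x)
sum-split zero    f = refl
sum-split (suc w) f = begin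
  f zero + sum (f ∘ suc)          ≡⟨ cong (f zero +_) (sum-split w (f ∘ suc)) ⟩
  f zero + (f (suc w) + rest)     ≡⟨ +-comm-middle (f zero) (f (suc w)) rest ⟩
  f (suc w) + (f zero + rest)     ∎
  where
  open ≡-Reasoning
  rest = sum (λ x → if does (x ≟ w) then 0 else f (suc x))
  +-comm-middle : ∀ a b c → a + (b + c) ≡ b + (a + c)
  +-comm-middle a b c = trans (sym (+-assoc a b c)) (trans (cong (_+ c) (+-comm a b)) (+-assoc b a c))

∑∈-mono : (S : Subset m) {f g : Fin m → ℕ} → (∀ {x} → x ∈ S → f x ≤ g x) → ∑∈ S f ≤ ∑∈ S g
∑∈-mono S {f} {g} f≤g = sum-mono term
  where
  term : ∀ x → (if S x then f x else 0) ≤ (if S x then g x else 0)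
  term x with S x in x∈S
  ... | true  = f≤g x∈S
  ... | false = z≤n

∑∈-⊆ : (S T : Subset m) {f : Fin m → ℕ} → (∀ {x} → x ∈ S → x ∈ T) → ∑∈ S f ≤ ∑∈ T f
∑∈-⊆ S T {f} S⊆T = sum-mono term
  where
  term : ∀ x → (if S x then f x else 0) ≤ (if T x then f x else 0)
  term x with S x in x∈S
  ... | true rewrite S⊆T x∈S = ≤-refl
  ... | false = z≤n

∑∈-+ : (S : Subset m) (f g : Fin m → ℕ) → ∑∈ S (λ x → f x + g x) ≡ ∑∈ S f + ∑∈ S g
∑∈-+ S f g = trans (sum-cong-≗ term) (∑-distrib-+ (λ x → if S x then f x else 0) (λ x → if S x then g x else 0))
  where
  term : ∀ x → (if S x then f x + g x else 0) ≡ (if S x then f x else 0) + (if S x then g x else 0)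
  term x with S x
  ... | true  = refl
  ... | false = refl

∑∈-* : (S : Subset m) (c : ℕ) (f : Fin m → ℕ) → ∑∈ S (λ x → c * f x) ≡ c * ∑∈ S f
∑∈-* S c f = trans (sum-cong-≗ term) (sym (*-distribˡ-sum c (λ x → if S x then f x else 0)))
  where
  term : ∀ x → (if S x then c * f x else 0) ≡ c * (if S x then f x else 0)
  term x with S x
  ... | true  = refl
  ... | false = sym (*-zeroʳ c)

∑∈-const : (S : Subset m) (c : ℕ) → ∑∈ S (λ _ → c) ≡ c * card S
∑∈-const S c = trans (sum-cong-≗ term) (∑∈-* S c (λ _ → 1))
  where
  term : ∀ x → (if S x then c else 0) ≡ (if S x then c * 1 else 0)
  term x = cong (λ k → if S x then k else 0) (sym (*-identityʳ c))

∑∈-filter : (S T : Subset m) (c : ℕ) → ∑∈ S (λ x → if T x then c else 0) ≡ c * card (S ∩ T)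
∑∈-filter S T c = trans (sum-cong-≗ term) (∑∈-const (S ∩ T) c)
  where
  term : ∀ x → (if S x then (if T x then c else 0) else 0) ≡ (if (S ∩ T) x then c else 0)
  term x with S x
  ... | true  = refl
  ... | false = refl

∑∈-remove : (S : Subset m) {w : Fin m} (f : Fin m → ℕ) → w ∈ S → ∑∈ S f ≡ f w + ∑∈ (S ∖ w) f
∑∈-remove S {w} f w∈S = trans (sum-split w _)
  (cong₂ _+_ (cong (λ b → if b then f w else 0) w∈S) (sum-cong-≗ term))
  where
  term : ∀ x → (if does (x ≟ w) then 0 else (if S x then f x else 0)) ≡ (if (S ∖ w) x then f x else 0)
  term x with S x | does (x ≟ w)
  ... | true  | true  = refl
  ... | true  | false = refl
  ... | false | true  = refl
  ... | false | false = refl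

if-sum : ∀ b (g : Fin m → ℕ) → (if b then sum g else 0) ≡ sum (λ y → if b then g y else 0)
if-sum     true  g = refl
if-sum {m} false g = sym (sum-replicate-zero m)

∑∈-comm : (S T : Subset m) (f : Fin m → Fin m → ℕ) →
          ∑∈ S (λ x → ∑∈ T (λ y → f x y)) ≡ ∑∈ T (λ y → ∑∈ S (λ x → f x y))
∑∈-comm {m} S T f = begin
  ∑∈ S (λ x → ∑∈ T (λ y → f x y))
    ≡⟨ sum-cong-≗ (λ x → if-sum (S x) (λ y → if T y then f x y else 0)) ⟩
  sum (λ x → sum (λ y → if S x then (if T y then f x y else 0) else 0))
    ≡⟨ ∑-comm {m} {m} (λ x y → if S x then (if T y then f x y else 0) else 0) ⟩
  sum (λ y → sum (λ x → if S x then (if T y then f x y else 0) else 0))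
    ≡⟨ sum-cong-≗ (λ y → sum-cong-≗ (λ x → swap (S x) (T y) (f x y))) ⟩
  sum (λ y → sum (λ x → if T y then (if S x then f x y else 0) else 0))
    ≡⟨ sum-cong-≗ (λ y → sym (if-sum (T y) (λ x → if S x then f x y else 0))) ⟩
  ∑∈ T (λ y → ∑∈ S (λ x → f x y)) ∎
  where
  open ≡-Reasoning
  swap : ∀ b c (k : ℕ) → (if b then (if c then k else 0) else 0) ≡ (if c then (if b then k else 0) else 0)
  swap true  true  k = refl
  swap true  false k = refl
  swap false true  k = refl
  swap false false k = refl

card-remove : (S : Subset m) {w : Fin m} → w ∈ S → card S ≡ suc (card (S ∖ w))
card-remove S = ∑∈-remove S (λ _ → 1)

card≡0⇒∉ : (S : Subset m) {x : Fin m} → card S ≡ 0 → ¬ x ∈ S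
card≡0⇒∉ S eq x∈S with () ← trans (sym eq) (card-remove S x∈S)

card≡1⇒≡ : (S : Subset m) {x y : Fin m} → card S ≡ 1 → x ∈ S → y ∈ S → x ≡ y
card≡1⇒≡ S {x} {y} eq x∈S y∈S with x ≟ y
... | yes x≡y = x≡y
... | no  x≢y = contradiction (∈-∖⁺ S x∈S x≢y)
                  (card≡0⇒∉ (S ∖ y) (suc-injective (trans (sym (card-remove S y∈S)) eq)))

card≡2⇒≡ : (S : Subset m) {x y z : Fin m} → card S ≡ 2 → x ∈ S → y ∈ S → z ∈ S → x ≢ z → y ≢ z → x ≡ y
card≡2⇒≡ S {z = z} eq x∈S y∈S z∈S x≢z y≢z =
  card≡1⇒≡ (S ∖ z) (suc-injective (trans (sym (card-remove S z∈S)) eq)) (∈-∖⁺ S x∈S x≢z) (∈-∖⁺ S y∈S y≢z)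

≤ᵇ-true : ∀ {a b} → (a ≤ᵇ b) ≡ true → a ≤ b
≤ᵇ-true {a} {b} p = ≤ᵇ⇒≤ a b (subst T (sym p) _)

-- Tournaments with bounded numbers of losses

-- ℓ x y is read "x loses to y"; d x is the total number of losses of x, of which
-- at least c are inflicted from outside S.
record Dominated (ℓ : Fin m → Subset m) (d : Fin m → ℕ) (c : ℕ) (S : Subset m) : Set where
  field
    total : ∀ {x y} → x ∈ S → y ∈ S → x ≢ y → y ∈ ℓ x ⊎ x ∈ ℓ y
    bound : ∀ {x} → x ∈ S → c + card (S ∩ ℓ x) ≤ d x

open Dominated

module _ {m : ℕ} {ℓ : Fin m → Subset m} {d : Fin m → ℕ} where

  ≤-losses : ∀ {c S x} → Dominated ℓ d c S → x ∈ S → c ≤ d x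
  ≤-losses {c} D x∈S = ≤-trans (m≤m+n c _) (bound D x∈S)

  -- Every remaining element loses to `w`, so removing `w` turns one loss inside the set into one
  -- inflicted from outside.
  peel : ∀ {c S w} → Dominated ℓ d c S → w ∈ S → (∀ {x} → x ∈ S ∖ w → w ∈ ℓ x) → Dominated ℓ d (suc c) (S ∖ w)
  peel {c} {S} {w} D w∈S loses = record
    { total = λ x∈ y∈ → total D (proj₁ (∈-∖⁻ S x∈)) (proj₁ (∈-∖⁻ S y∈))
    ; bound = λ {x} x∈ → begin
        suc c + card ((S ∖ w) ∩ ℓ x)    ≡⟨ +-suc c _ ⟨
        c + suc (card ((S ∖ w) ∩ ℓ x))
          ≤⟨ +-monoʳ-≤ c (s≤s (∑∈-⊆ ((S ∖ w) ∩ ℓ x) ((S ∩ ℓ x) ∖ w) (reorder x))) ⟩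
        c + suc (card ((S ∩ ℓ x) ∖ w))  ≡⟨ cong (c +_) (card-remove (S ∩ ℓ x) (∈-∩⁺ S (ℓ x) w∈S (loses x∈))) ⟨
        c + card (S ∩ ℓ x)              ≤⟨ bound D (proj₁ (∈-∖⁻ S x∈)) ⟩
        d x                             ∎
    }
    where
    open ≤-Reasoning
    reorder : ∀ x {y} → y ∈ (S ∖ w) ∩ ℓ x → y ∈ (S ∩ ℓ x) ∖ w
    reorder x y∈ with y∈S∖w , y∈ℓ ← ∈-∩⁻ (S ∖ w) (ℓ x) y∈ with y∈S , y≢w ← ∈-∖⁻ S y∈S∖w =
      ∈-∖⁺ (S ∩ ℓ x) (∈-∩⁺ S (ℓ x) y∈S y∈ℓ) y≢w

  -- The `c` outside losses already use up `d w`, so `w` loses to nothing in `S`; by totality every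
  -- other element loses to `w`.
  peel-minimal : ∀ {c S w} → Dominated ℓ d c S → w ∈ S → d w ≤ c → Dominated ℓ d (suc c) (S ∖ w)
  peel-minimal {c} {S} {w} D w∈S dw≤c = peel D w∈S loses
    where
    wins : card (S ∩ ℓ w) ≡ 0
    wins = n≤0⇒n≡0 (+-cancelˡ-≤ c _ _ (≤-trans (bound D w∈S) (≤-trans dw≤c (≤-reflexive (sym (+-identityʳ c))))))
    loses : ∀ {x} → x ∈ S ∖ w → w ∈ ℓ x
    loses x∈ with x∈S , x≢w ← ∈-∖⁻ S x∈ with total D x∈S w∈S x≢w
    ... | inj₁ w∈ℓx = w∈ℓx
    ... | inj₂ x∈ℓw = contradiction (∈-∩⁺ S (ℓ w) x∈S x∈ℓw) (card≡0⇒∉ (S ∩ ℓ w) wins)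

  -- Double counting: let `U` be the `N` elements with at most `c + j` losses. Each has at most `j`
  -- losses inside `U`, and each ordered pair in `U` is diagonal or a loss in some direction, so
  -- `N * N ≤ (2 * j + 1) * N`.
  count-≤ : ∀ {c S} → Dominated ℓ d c S → ∀ j → card (S ∩ (λ x → d x ≤ᵇ c + j)) ≤ 2 * j + 1
  count-≤ {c} {S} D j = cancel (begin
    N * N                                              ≡⟨ ∑∈-const U N ⟨
    ∑∈ U (λ x → N)                                     ≤⟨ ∑∈-mono U (λ x∈ → ∑∈-mono U (λ y∈ → one≤ x∈ y∈)) ⟩
    ∑∈ U (λ x → ∑∈ U (λ y → (L x y + L y x) + δ x y))
      ≤⟨ ∑∈-mono U (λ {x} _ → ≤-reflexive (trans (∑∈-+ U (λ y → L x y + L y x) (δ x)) (cong (_+ ∑∈ U (δ x)) (∑∈-+ U (L x) (λ y → L y x))))) ⟩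
    ∑∈ U (λ x → (∑∈ U (L x) + ∑∈ U (λ y → L y x)) + ∑∈ U (δ x))
      ≡⟨ trans (∑∈-+ U _ (λ x → ∑∈ U (δ x))) (cong (_+ ∑∈ U (λ x → ∑∈ U (δ x))) (∑∈-+ U _ _)) ⟩
    (∑∈ U (λ x → ∑∈ U (L x)) + ∑∈ U (λ x → ∑∈ U (λ y → L y x))) + ∑∈ U (λ x → ∑∈ U (δ x))
      -- Losses inflicted and losses suffered have the same total.
      ≡⟨ cong (λ k → (∑∈ U (λ x → ∑∈ U (L x)) + k) + ∑∈ U (λ x → ∑∈ U (δ x))) (∑∈-comm U U (λ x y → L y x)) ⟩
    (∑∈ U (λ x → ∑∈ U (L x)) + ∑∈ U (λ x → ∑∈ U (L x))) + ∑∈ U (λ x → ∑∈ U (δ x))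
      ≤⟨ +-mono-≤ (+-mono-≤ few few) (∑∈-mono U diag) ⟩
    (∑∈ U (λ _ → j) + ∑∈ U (λ _ → j)) + ∑∈ U (λ _ → 1)
      ≡⟨ cong (λ k → (k + k) + N) (∑∈-const U j) ⟩
    (j * N + j * N) + N
      ≡⟨ solve 2 (λ j n → (j :* n :+ j :* n) :+ n := (con 2 :* j :+ con 1) :* n) refl j N ⟩
    (2 * j + 1) * N                                    ∎)
    where
    open ≤-Reasoning
    open +-*-Solver
    low U : Subset m
    low x = d x ≤ᵇ c + j
    U = S ∩ low
    N = card U
    L δ : Fin m → Fin m → ℕ
    L x y = if ℓ x y then 1 else 0
    δ x y = if does (y ≟ x) then 1 else 0
    cancel : ∀ {n k} → n * n ≤ k * n → n ≤ k
    cancel {zero}          _ = z≤n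
    cancel {suc n} {k} n²≤kn = *-cancelʳ-≤ (suc n) k (suc n) n²≤kn
    one≤ : ∀ {x y} → x ∈ U → y ∈ U → 1 ≤ (L x y + L y x) + δ x y
    one≤ {x} {y} x∈ y∈ with y ≟ x
    ... | yes _ = m≤n+m 1 _
    ... | no y≢x with total D (proj₁ (∈-∩⁻ S low x∈)) (proj₁ (∈-∩⁻ S low y∈)) (y≢x ∘ sym)
    ...   | inj₁ p rewrite p = s≤s z≤n
    ...   | inj₂ p rewrite p = ≤-trans (m≤n+m 1 (L x y)) (m≤m+n _ 0)
    few : ∑∈ U (λ x → ∑∈ U (L x)) ≤ ∑∈ U (λ _ → j)
    few = ∑∈-mono U λ {x} x∈ → +-cancelˡ-≤ c _ _ (begin
      c + ∑∈ U (L x)         ≡⟨ cong (c +_) (trans (∑∈-filter U (ℓ x) 1) (*-identityˡ _)) ⟩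
      c + card (U ∩ ℓ x)     ≤⟨ +-monoʳ-≤ c (∑∈-⊆ (U ∩ ℓ x) (S ∩ ℓ x) (λ y∈ →
                                  let y∈U , y∈ℓ = ∈-∩⁻ U (ℓ x) y∈ in ∈-∩⁺ S (ℓ x) (proj₁ (∈-∩⁻ S low y∈U)) y∈ℓ)) ⟩
      c + card (S ∩ ℓ x)     ≤⟨ bound D (proj₁ (∈-∩⁻ S low x∈)) ⟩
      d x                    ≤⟨ ≤ᵇ-true (proj₂ (∈-∩⁻ S low x∈)) ⟩
      c + j                  ∎)
    diag : ∀ {x} → x ∈ U → ∑∈ U (δ x) ≤ 1
    diag {x} x∈ = ≤-reflexive (begin-equality
      ∑∈ U (δ x)              ≡⟨ trans (∑∈-filter U E 1) (*-identityˡ _) ⟩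
      card (U ∩ E)            ≡⟨ card-remove (U ∩ E) x∈UE ⟩
      suc (card (U ∩ E ∖ x))  ≡⟨ cong suc (empty (U ∩ E ∖ x) none) ⟩
      1                       ∎)
      where
      E : Subset m
      E y = does (y ≟ x)
      x∈UE : x ∈ U ∩ E
      x∈UE = ∈-∩⁺ U E x∈ (dec-true (x ≟ x) refl)
      empty : (V : Subset m) → (∀ y → V y ≡ false) → card V ≡ 0
      empty V V≡∅ = trans (sum-cong-≗ (λ y → cong (λ b → if b then 1 else 0) (V≡∅ y))) (sum-replicate-zero m)
      none : ∀ y → (U ∩ E ∖ x) y ≡ false
      none y with U y | does (y ≟ x)
      ... | true  | true  = refl
      ... | true  | false = refl
      ... | false | _     = refl

  -- Abel summation against the counts of count-≤; the right-hand side solves the resulting recursion exactly.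
  capped-sum : ∀ {c S K} → Dominated ℓ d c S → (∀ x → d x ≤ K) → ∀ i J → c + J + i ≡ K →
               3 * ∑∈ S (λ x → 4 ^ (K ∸ (d x ⊔ (c + J)))) ≤ (6 * J + 5) * 4 ^ i
  capped-sum {c} {S} {K} D d≤K zero J eq = begin
    3 * ∑∈ S (λ x → 4 ^ (K ∸ (d x ⊔ (c + J))))         ≤⟨ *-monoʳ-≤ 3 (∑∈-mono S (λ {x} _ → base x)) ⟩
    3 * ∑∈ S (λ x → if d x ≤ᵇ c + J then 1 else 0)     ≡⟨ cong (3 *_) (∑∈-filter S _ 1) ⟩
    3 * (1 * card (S ∩ (λ x → d x ≤ᵇ c + J)))          ≤⟨ *-monoʳ-≤ 3 (*-monoʳ-≤ 1 (count-≤ D J)) ⟩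
    -- With `2 * J + 1` elements at the cap and two more at each higher deficit forever, the
    -- geometric series would give `(6 * J + 5) / 3`; truncation at `K` leaves this slack of 2.
    3 * (1 * (2 * J + 1))                              ≤⟨ m≤m+n _ 2 ⟩
    3 * (1 * (2 * J + 1)) + 2
      ≡⟨ solve 1 (λ J → con 3 :* (con 1 :* (con 2 :* J :+ con 1)) :+ con 2 := (con 6 :* J :+ con 5) :* con 1) refl J ⟩
    (6 * J + 5) * 1                                    ∎
    where
    open ≤-Reasoning
    open +-*-Solver
    c+J≡K : c + J ≡ K
    c+J≡K = trans (sym (+-identityʳ _)) eq
    base : ∀ x → 4 ^ (K ∸ (d x ⊔ (c + J))) ≤ (if d x ≤ᵇ c + J then 1 else 0)
    base x rewrite c+J≡K | m≤n⇒m⊔n≡n (d≤K x) | n∸n≡0 K with d x ≤ᵇ K | ≤⇒≤ᵇ (d≤K x)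
    ... | true | _ = ≤-refl
  capped-sum {c} {S} {K} D d≤K (suc i) J eq = begin
    3 * ∑∈ S (λ x → 4 ^ (K ∸ (d x ⊔ (c + J))))
      -- Raising the cap by one lowers the term of an element with at most `c + J` losses from
      -- `4 ^ suc i` to `4 ^ i`, a difference of `3 * 4 ^ i`, and leaves the other terms unchanged.
      ≤⟨ *-monoʳ-≤ 3 (∑∈-mono S (λ {x} _ → step x)) ⟩
    3 * ∑∈ S (λ x → 4 ^ (K ∸ (d x ⊔ (c + suc J))) + (if d x ≤ᵇ c + J then 3 * 4 ^ i else 0))
      ≡⟨ cong (3 *_) (trans (∑∈-+ S _ _) (cong (∑∈ S (λ x → 4 ^ (K ∸ (d x ⊔ (c + suc J)))) +_) (∑∈-filter S _ (3 * 4 ^ i)))) ⟩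
    3 * (∑∈ S (λ x → 4 ^ (K ∸ (d x ⊔ (c + suc J)))) + 3 * 4 ^ i * card (S ∩ (λ x → d x ≤ᵇ c + J)))
      ≡⟨ *-distribˡ-+ 3 (∑∈ S (λ x → 4 ^ (K ∸ (d x ⊔ (c + suc J))))) _ ⟩
    3 * ∑∈ S (λ x → 4 ^ (K ∸ (d x ⊔ (c + suc J)))) + 3 * (3 * 4 ^ i * card (S ∩ (λ x → d x ≤ᵇ c + J)))
      ≤⟨ +-mono-≤ (capped-sum D d≤K i (suc J) eq′) (*-monoʳ-≤ 3 (*-monoʳ-≤ (3 * 4 ^ i) (count-≤ D J))) ⟩
    (6 * suc J + 5) * 4 ^ i + 3 * (3 * 4 ^ i * (2 * J + 1))
      ≡⟨ solve 2 (λ J p → (con 6 :* (con 1 :+ J) :+ con 5) :* p :+ con 3 :* (con 3 :* p :* (con 2 :* J :+ con 1)) := (con 6 :* J :+ con 5) :* (con 4 :* p)) refl J (4 ^ i) ⟩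
    (6 * J + 5) * 4 ^ suc i ∎
    where
    open ≤-Reasoning
    open +-*-Solver
    eq′ : c + suc J + i ≡ K
    eq′ = trans (cong (_+ i) (+-suc c J)) (trans (sym (+-suc (c + J) i)) eq)
    K∸ : K ∸ (c + J) ≡ suc i
    K∸ = trans (cong (_∸ (c + J)) (sym eq)) (m+n∸m≡n (c + J) (suc i))
    K∸′ : K ∸ (c + suc J) ≡ i
    K∸′ = trans (cong (_∸ (c + suc J)) (sym eq′)) (m+n∸m≡n (c + suc J) i)
    step : ∀ x → 4 ^ (K ∸ (d x ⊔ (c + J))) ≤ 4 ^ (K ∸ (d x ⊔ (c + suc J))) + (if d x ≤ᵇ c + J then 3 * 4 ^ i else 0)
    step x with d x ≤ᵇ c + J in low
    ... | true  = ≤-reflexive (trans (cong (λ k → 4 ^ (K ∸ k)) (m≤n⇒m⊔n≡n dx≤))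
        (trans (cong (4 ^_) K∸) (sym (cong (λ k → k + 3 * 4 ^ i) (trans (cong (λ k → 4 ^ (K ∸ k)) (m≤n⇒m⊔n≡n (≤-trans dx≤ (+-monoʳ-≤ c (n≤1+n J))))) (cong (4 ^_) K∸′))))))
      where
      dx≤ : d x ≤ c + J
      dx≤ = ≤ᵇ-true low
    ... | false = ≤-reflexive (trans (cong (λ k → 4 ^ (K ∸ k)) (trans (m≥n⇒m⊔n≡m (<⇒≤ dx>)) (sym (m≥n⇒m⊔n≡m (≤-trans (≤-reflexive (+-suc c J)) dx>))))) (sym (+-identityʳ _)))
      where
      dx> : c + J < d x
      dx> = ≰⇒> λ le → subst T low (≤⇒≤ᵇ le)

card-≤ : ∀ {m} (S : Subset m) → card S ≤ m
card-≤ {zero}  S = z≤n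
card-≤ {suc m} S with S zero
... | true  = s≤s (card-≤ (S ∘ suc))
... | false = m≤n⇒m≤1+n (card-≤ (S ∘ suc))

-- Redistribution of the edge weights

-- The arguments tell whether the receiving end and the opposite end are matched. The shares of the
-- two ends add up to 2 because a sum over ordered pairs meets each edge twice.
share : Bool → Bool → ℕ
share true  false = 0
share false true  = 2
share _     _     = 1

-- An edge of deficit k carries weight 4^(3+m∸k). If k ≤ 2, a matched end hands its
-- half of the weight over to an unmatched one.
weight : ℕ → ℕ → Bool → Bool → ℕ
weight m k b c = (if k ≤ᵇ 2 then share b c else 1) * 4 ^ (3 + m ∸ k)

module _ (m : ℕ) where

  private
    Q = 4 ^ m
    1* : ∀ {a} → 1 * a ≤ a
    1* = ≤-reflexive (*-identityˡ _)

  weight-split : ∀ k b c → weight m k b c + weight m k c b ≡ 2 * 4 ^ (3 + m ∸ k)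
  weight-split k b c = trans (sym (*-distribʳ-+ (4 ^ (3 + m ∸ k)) (if k ≤ᵇ 2 then share b c else 1) (if k ≤ᵇ 2 then share c b else 1))) (cong (_* 4 ^ (3 + m ∸ k)) (two (k ≤ᵇ 2) b c))
    where
    two : ∀ t b c → (if t then share b c else 1) + (if t then share c b else 1) ≡ 2
    two false _     _     = refl
    two true  true  true  = refl
    two true  true  false = refl
    two true  false true  = refl
    two true  false false = refl

  weight-≤ : ∀ k b c → weight m k b c ≤ 2 * 4 ^ (3 + m ∸ k)
  weight-≤ k b c = ≤-trans (m≤m+n _ _) (≤-reflexive (weight-split k b c))

  weight-matched-≤ : ∀ k c → weight m k true c ≤ 4 ^ (3 + m ∸ k)
  weight-matched-≤ k c = ≤-trans (*-monoˡ-≤ (4 ^ (3 + m ∸ k)) (one (k ≤ᵇ 2) c)) 1*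
    where
    one : ∀ t c → (if t then share true c else 1) ≤ 1
    one false _     = s≤s z≤n
    one true  true  = s≤s z≤n
    one true  false = z≤n

  weight-high : ∀ k b c → 3 ≤ k → weight m k b c ≤ 4 ^ (3 + m ∸ (k ⊔ 3))
  weight-high (suc (suc (suc k))) b c (s≤s (s≤s (s≤s _))) rewrite ⊔-identityʳ k = 1*

  -- Edges of deficit 1 or 2 to an unmatched vertex have been handed over entirely; from deficit 3
  -- on the cap is inactive and the share is 1.
  weight-matched : ∀ k c → 1 ≤ k → (k ≡ 1 → c ≡ false) → (k ≡ 2 → c ≡ false) →
                   weight m k true c ≤ 4 ^ (3 + m ∸ (k ⊔ 3))
  weight-matched 1                     c _ h₁ _  rewrite h₁ refl = z≤n
  weight-matched 2                     c _ _  h₂ rewrite h₂ refl = z≤n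
  weight-matched k@(suc (suc (suc _))) c _ _  _  = weight-high k true c (s≤s (s≤s (s≤s z≤n)))

  -- The excess over the cap is written with indicators of `k ≤ 1` and `k ≤ 2`, the quantities that
  -- `count-≤` controls: `16 = 4 + 8 + 4` for an evenly split edge of deficit 1, and `2 * 4 = 4 + 4`
  -- for deficit 2.
  weight-unmatched₁ : ∀ k c → 1 ≤ k → (k ≡ 1 → c ≡ false) → weight m k false c ≤
    4 ^ (3 + m ∸ (k ⊔ 2)) + (if k ≤ᵇ 1 then 8 * Q else 0) + (if k ≤ᵇ 2 then 4 * Q else 0)
  weight-unmatched₁ 1 c _ h₁ rewrite h₁ refl = ≤-reflexive
    (solve 1 (λ q → con 1 :* (con 4 :* (con 4 :* q)) := con 4 :* q :+ con 8 :* q :+ con 4 :* q) refl Q)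
    where open +-*-Solver
  weight-unmatched₁ 2 c _ _ = ≤-trans (weight-≤ 2 false c) (≤-reflexive
    (solve 1 (λ q → con 2 :* (con 4 :* q) := con 4 :* q :+ con 0 :+ con 4 :* q) refl Q))
    where open +-*-Solver
  weight-unmatched₁ (suc (suc (suc k))) c _ _ = ≤-trans 1* (≤-trans (m≤m+n _ 0) (m≤m+n _ 0))

  -- With deficit 1 excluded the cap can be 3, and only an edge of deficit 2 exceeds it, by at most
  -- `8 - 1 = 7` units.
  weight-unmatched₂ : ∀ k c → 2 ≤ k → weight m k false c ≤
    4 ^ (3 + m ∸ (k ⊔ 3)) + (if k ≤ᵇ 2 then 7 * Q else 0)
  weight-unmatched₂ 2 c _ = ≤-trans (weight-≤ 2 false c) (≤-reflexive
    (solve 1 (λ q → con 2 :* (con 4 :* q) := q :+ con 7 :* q) refl Q))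
    where open +-*-Solver
  weight-unmatched₂ k@(suc (suc (suc _))) c _ =
    ≤-trans (weight-high k false c (s≤s (s≤s (s≤s z≤n)))) (m≤m+n _ 0)
  weight-unmatched₂ 1 c (s≤s ())

  -- In units of Q an edge of deficit 0, 1, 2, 3 weighs 64, 16, 4, 1, and 5312 = 83 · 64.
  budget : ∀ A B {F s} → F ≤ A * Q + s → 3 * s ≤ B * Q → 72 * A + 24 * B ≤ 5312 →
           72 * F ≤ 83 * 4 ^ (3 + m)
  budget A B {F} {s} F≤ s≤ AB≤ = begin
    72 * F                        ≤⟨ *-monoʳ-≤ 72 F≤ ⟩
    72 * (A * Q + s)
      ≡⟨ solve 3 (λ A q s → con 72 :* (A :* q :+ s) := con 72 :* A :* q :+ con 24 :* (con 3 :* s)) refl A Q s ⟩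
    72 * A * Q + 24 * (3 * s)     ≤⟨ +-monoʳ-≤ (72 * A * Q) (*-monoʳ-≤ 24 s≤) ⟩
    72 * A * Q + 24 * (B * Q)
      ≡⟨ solve 3 (λ A B q → con 72 :* A :* q :+ con 24 :* (B :* q) := (con 72 :* A :+ con 24 :* B) :* q) refl A B Q ⟩
    (72 * A + 24 * B) * Q         ≤⟨ *-monoˡ-≤ Q AB≤ ⟩
    5312 * Q
      ≡⟨ solve 1 (λ q → con 5312 :* q := con 83 :* (con 4 :* (con 4 :* (con 4 :* q)))) refl Q ⟩
    83 * 4 ^ (3 + m)              ∎
    where
    open ≤-Reasoning
    open +-*-Solver

-- W x y z: the triple {x,y,z} chooses the pair xy.
module Graph {m : ℕ} (W : Fin m → Fin m → Subset m)
  (W-sym : ∀ x y z → W x y z ≡ W y x z)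
  (W-excl : ∀ {x y z} → y ≢ x → z ≢ x → y ≢ z → W x y z ≡ true → W x z y ≡ false)
  where

  -- If the triple chooses `xy`, both `vx` and `vy` lose, so losses may be mutual. The two
  -- inequalities keep degenerate triples out of the deficit.
  loss : Fin m → Fin m → Subset m
  loss v x y = not (W v x y) ∧ (not (does (y ≟ v)) ∧ not (does (y ≟ x)))

  loss-sym : ∀ v x y → loss v x y ≡ loss x v y
  loss-sym v x y = cong₂ _∧_ (cong not (W-sym v x y)) (Bool.∧-comm (not (does (y ≟ v))) _)

  loss-total : ∀ {v x y} → x ≢ v → y ≢ v → x ≢ y → y ∈ loss v x ⊎ x ∈ loss v y
  loss-total {v} {x} {y} x≢v y≢v x≢y
    rewrite dec-false (y ≟ v) y≢v | dec-false (y ≟ x) (x≢y ∘ sym) | dec-false (x ≟ v) x≢v | dec-false (x ≟ y) x≢y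
    with W v x y in Wvxy
  ... | false = inj₁ refl
  ... | true rewrite W-excl x≢v y≢v x≢y Wvxy = inj₂ refl

  -- Deficits and the deficit-0 matching in an induced TCM

  module Induced (Y : Subset m) where

    d : Fin m → Fin m → ℕ
    d v x = card (Y ∩ loss v x)

    d-sym : ∀ v x → d v x ≡ d x v
    d-sym v x = sum-cong-≗ (λ y → cong (λ b → if Y y ∧ b then 1 else 0) (loss-sym v x y))

    d≤ : ∀ v x → d v x ≤ 3 + m
    d≤ v x = ≤-trans (card-≤ (Y ∩ loss v x)) (m≤n+m m 3)

    Partner : Fin m → Fin m → Set
    Partner v a = a ∈ Y × a ≢ v × d v a ≡ 0

    partner? : ∀ v → Dec (∃ (Partner v))
    partner? v = any? (λ a → (Y a Bool.≟ true) ×-dec (¬? (a ≟ v) ×-dec (d v a ℕ.≟ 0)))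

    matched : Subset m
    matched v = does (partner? v)

    partner : ∀ {v} → v ∈ matched → ∃ (Partner v)
    partner {v} v∈ with yes p ← partner? v = p

    star : ∀ v → Dominated (loss v) (d v) 0 (Y ∖ v)
    star v = record
      { total = λ x∈ y∈ x≢y → loss-total (proj₂ (∈-∖⁻ Y x∈)) (proj₂ (∈-∖⁻ Y y∈)) x≢y
      ; bound = λ {x} _ → ∑∈-⊆ (Y ∖ v ∩ loss v x) (Y ∩ loss v x) (λ y∈ →
          let y∈Yv , y∈ℓ = ∈-∩⁻ (Y ∖ v) (loss v x) y∈ in ∈-∩⁺ Y (loss v x) (proj₁ (∈-∖⁻ Y y∈Yv)) y∈ℓ)
      }

    -- The edge `va` has deficit 0 and loses to nothing, so totality makes every other edge at `v`
    -- lose to it. Hence a partner is unique.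
    loses-to-partner : ∀ {v a x} → Partner v a → x ∈ Y → x ≢ v → x ≢ a → a ∈ Y ∩ loss v x
    loses-to-partner {v} {a} {x} (a∈Y , a≢v , dva≡0) x∈Y x≢v x≢a with loss-total x≢v a≢v x≢a
    ... | inj₁ a∈ = ∈-∩⁺ Y (loss v x) a∈Y a∈
    ... | inj₂ x∈ = contradiction (∈-∩⁺ Y (loss v a) x∈Y x∈) (card≡0⇒∉ (Y ∩ loss v a) dva≡0)

    -- The same triple seen from the other end: at `x` the edge `xv` loses to `xp`, and `loss` is
    -- symmetric in the ends of the edge. So the partner of `x` also costs `vx` a loss at `v`.
    loses-to-partner′ : ∀ {v x p} → Partner x p → v ∈ Y → v ≢ x → v ≢ p → p ∈ Y ∩ loss v x
    loses-to-partner′ {v} {x} {p} xp v∈Y v≢x v≢p =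
      trans (cong (Y p ∧_) (loss-sym v x p)) (loses-to-partner xp v∈Y v≢x v≢p)

    partner-unique : ∀ {v a b} → Partner v a → Partner v b → a ≡ b
    partner-unique {v} {a} {b} va (b∈Y , b≢v , dvb≡0) with b ≟ a
    ... | yes b≡a = sym b≡a
    ... | no  b≢a = contradiction (loses-to-partner va b∈Y b≢v b≢a) (card≡0⇒∉ (Y ∩ loss v b) dvb≡0)

    partner-sym : ∀ {v a} → v ∈ Y → Partner v a → Partner a v
    partner-sym {v} {a} v∈Y (_ , a≢v , dva≡0) = v∈Y , a≢v ∘ sym , trans (d-sym a v) dva≡0

    share-of : Fin m → Fin m → ℕ
    share-of v x = weight m (d v x) (matched v) (matched x)

    module Vertex {v : Fin m} (v∈Y : v ∈ Y) where

      private
        Q = 4 ^ m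
        g = share-of v
        R = Y ∖ v
        F = ∑∈ R g
        cap : ℕ → Fin m → ℕ
        cap J x = 4 ^ (3 + m ∸ (d v x ⊔ J))

      ≤2* : ∀ k {x} → d v x ≡ k → g x ≤ 2 * 4 ^ (3 + m ∸ k)
      ≤2* k {x} refl = weight-≤ m (d v x) (matched v) (matched x)

      -- The weight received by a matched vertex

      module Matched {a : Fin m} (va : Partner v a) where

        v-matched : v ∈ matched
        v-matched = dec-true (partner? v) (a , va)

        a∈R : a ∈ R
        a∈R = ∈-∖⁺ Y (proj₁ va) (proj₁ (proj₂ va))

        S : Subset m
        S = R ∖ a

        D₁ : Dominated (loss v) (d v) 1 S
        D₁ = peel-minimal (star v) a∈R (≤-reflexive (proj₂ (proj₂ va)))

        ∈S⁻ : ∀ {x} → x ∈ S → x ∈ Y × x ≢ v × x ≢ a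
        ∈S⁻ x∈S with x∈R , x≢a ← ∈-∖⁻ R x∈S with x∈Y , x≢v ← ∈-∖⁻ Y x∈R = x∈Y , x≢v , x≢a

        a∈losses : ∀ {x} → x ∈ S → a ∈ Y ∩ loss v x
        a∈losses x∈S with x∈Y , x≢v , x≢a ← ∈S⁻ x∈S = loses-to-partner va x∈Y x≢v x≢a

        partner≢v : ∀ {x p} → x ∈ S → Partner x p → v ≢ p
        partner≢v x∈S xv refl with x∈Y , x≢v , x≢a ← ∈S⁻ x∈S = x≢a (partner-unique (partner-sym x∈Y xv) va)

        partner≢a : ∀ {x p} → x ∈ S → Partner x p → p ≢ a
        partner≢a x∈S xa refl with x∈Y , x≢v , x≢a ← ∈S⁻ x∈S =
          x≢v (partner-unique (partner-sym x∈Y xa) (partner-sym v∈Y va))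

        p∈losses : ∀ {x p} → x ∈ S → Partner x p → p ∈ Y ∩ loss v x
        p∈losses x∈S xp = loses-to-partner′ xp v∈Y (proj₁ (proj₂ (∈S⁻ x∈S)) ∘ sym) (partner≢v x∈S xp)

        -- The edge `vx` already loses to `va`; a partner of `x` would inflict a second, different
        -- loss.
        d≡1⇒unmatched : ∀ {x} → x ∈ S → d v x ≡ 1 → matched x ≡ false
        d≡1⇒unmatched {x} x∈S d≡1 with partner? x
        ... | no _ = refl
        ... | yes (p , xp) = contradiction (card≡1⇒≡ (Y ∩ loss v x) d≡1 (p∈losses x∈S xp) (a∈losses x∈S)) (partner≢a x∈S xp)

        -- Besides `va`, these are the only edges of deficit below 3 of which the matched `v` keeps
        -- a share.
        Heavy : Fin m → Set
        Heavy x = x ∈ S × d v x ≡ 2 × x ∈ matched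

        heavy? : ∀ x → Dec (Heavy x)
        heavy? x = (S x Bool.≟ true) ×-dec ((d v x ℕ.≟ 2) ×-dec (matched x Bool.≟ true))

        light : ∀ {x} → x ∈ S → ¬ Heavy x → g x ≤ cap 3 x
        light {x} x∈S ¬heavy rewrite v-matched = weight-matched m (d v x) (matched x) (≤-losses D₁ x∈S)
          (d≡1⇒unmatched x∈S) (λ d≡2 → Bool.¬-not (λ mx → ¬heavy (x∈S , d≡2 , mx)))

        ≤a : g a ≤ 64 * Q
        ≤a rewrite v-matched | proj₂ (proj₂ va) = ≤-trans (weight-matched-≤ m 0 (matched a))
          (≤-reflexive (solve 1 (λ q → con 4 :* (con 4 :* (con 4 :* q)) := con 64 :* q) refl Q))
          where open +-*-Solver

        ≤heavy : ∀ {x} → Heavy x → g x ≤ 4 * Q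
        ≤heavy {x} (_ , d≡2 , _) rewrite v-matched | d≡2 = weight-matched-≤ m 2 (matched x)

        -- The two losses of a heavy `vx` are to `a` and to the partner of `x`. One of `vx`, `vy`
        -- loses to the other, and as neither `x` nor `y` is `a`, the winner must be the partner of
        -- the loser.
        two-heavy⇒partners : ∀ {x y} → Heavy x → Heavy y → y ≢ x → Partner x y
        two-heavy⇒partners {x} {y} (x∈S , dx≡2 , mx) (y∈S , dy≡2 , my) y≢x
          with p , xp ← partner mx | q , yq ← partner my with y ≟ p
        ... | yes refl = xp
        ... | no y≢p with loss-total (proj₁ (proj₂ (∈S⁻ x∈S))) (proj₁ (proj₂ (∈S⁻ y∈S))) (y≢x ∘ sym)
        ...   | inj₁ y∈ℓx = contradiction
                (card≡2⇒≡ (Y ∩ loss v x) dx≡2 (∈-∩⁺ Y (loss v x) (proj₁ (∈S⁻ y∈S)) y∈ℓx) (p∈losses x∈S xp)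
                  (a∈losses x∈S) (proj₂ (proj₂ (∈S⁻ y∈S))) (partner≢a x∈S xp)) y≢p
        ...   | inj₂ x∈ℓy with refl ← card≡2⇒≡ (Y ∩ loss v y) dy≡2 (∈-∩⁺ Y (loss v y) (proj₁ (∈S⁻ x∈S)) x∈ℓy) (p∈losses y∈S yq)
                  (a∈losses y∈S) (proj₂ (proj₂ (∈S⁻ x∈S))) (partner≢a y∈S yq)
                = partner-sym (proj₁ (∈S⁻ y∈S)) yq

        -- Both losses of `vx` are accounted for, by `a` and by `y`, so `vx` cannot lose to a third
        -- edge `vz`.
        two-heavy-dominate : ∀ {x y z} → Heavy x → Heavy y → y ≢ x → z ∈ S → z ≢ x → z ≢ y → x ∈ loss v z
        two-heavy-dominate {x} {y} {z} hx@(x∈S , dx≡2 , _) hy y≢x z∈S z≢x z≢y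
          with loss-total (proj₁ (proj₂ (∈S⁻ z∈S))) (proj₁ (proj₂ (∈S⁻ x∈S))) z≢x
        ... | inj₁ x∈ = x∈
        ... | inj₂ z∈ = contradiction
          (card≡2⇒≡ (Y ∩ loss v x) dx≡2 (∈-∩⁺ Y (loss v x) (proj₁ (∈S⁻ z∈S)) z∈)
            (p∈losses x∈S xy) (a∈losses x∈S) (proj₂ (proj₂ (∈S⁻ z∈S))) (partner≢a x∈S xy)) z≢y
          where xy = two-heavy⇒partners hx hy y≢x

        F≡ : F ≡ g a + ∑∈ S g
        F≡ = ∑∈-remove R g a∈R

        no-heavy : ¬ ∃ Heavy → 72 * F ≤ 83 * 4 ^ (3 + m)
        -- 64 is the bound for `va`. The cap 3 is `c + J` with `c = 1` from peeling `a`, so `J = 2`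
        -- and `6 * J + 5 = 17`.
        no-heavy none = budget m 64 17
          (≤-trans (≤-reflexive F≡) (+-mono-≤ ≤a (∑∈-mono S (λ {x} x∈S → light x∈S (λ h → none (x , h))))))
          (capped-sum D₁ (d≤ v) m 2 refl) (≤ᵇ⇒≤ _ _ _)

        one-heavy : ∀ {x} → Heavy x → (∀ {y} → y ≢ x → ¬ Heavy y) → 72 * F ≤ 83 * 4 ^ (3 + m)
        -- The heavy edge adds 4 units, and `72 * 68 + 24 * 17 = 5304` just fits under 5312.
        one-heavy {x} hx@(x∈S , _) only = budget m 68 17
          (begin
            F                                   ≡⟨ trans F≡ (cong (g a +_) (∑∈-remove S g x∈S)) ⟩
            g a + (g x + ∑∈ (S ∖ x) g)          ≤⟨ +-mono-≤ ≤a (+-mono-≤ (≤heavy hx) (∑∈-mono (S ∖ x) rest)) ⟩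
            64 * Q + (4 * Q + ∑∈ (S ∖ x) (cap 3))
              ≤⟨ +-monoʳ-≤ (64 * Q) (+-monoʳ-≤ (4 * Q) (∑∈-⊆ (S ∖ x) S (proj₁ ∘ ∈-∖⁻ S))) ⟩
            64 * Q + (4 * Q + ∑∈ S (cap 3))
              ≡⟨ solve 2 (λ q s → con 64 :* q :+ (con 4 :* q :+ s) := con 68 :* q :+ s) refl Q _ ⟩
            68 * Q + ∑∈ S (cap 3)               ∎)
          (capped-sum D₁ (d≤ v) m 2 refl) (≤ᵇ⇒≤ _ _ _)
          where
          open ≤-Reasoning
          open +-*-Solver
          rest : ∀ {y} → y ∈ S ∖ x → g y ≤ cap 3 y
          rest y∈ with y∈S , y≢x ← ∈-∖⁻ S y∈ = light y∈S (only y≢x)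

        two-heavy : ∀ {x y} → Heavy x → Heavy y → y ≢ x → 72 * F ≤ 83 * 4 ^ (3 + m)
        -- `72 = 64 + 4 + 4`. Peeling `a`, `x` and `y` forces all other deficits up to 3, so `J = 0`
        -- and 17 drops to 5; the total is again 5304.
        two-heavy {x} {y} hx@(x∈S , _) hy@(y∈S , _) y≢x = budget m 72 5
          (begin
            F
              ≡⟨ trans F≡ (cong (g a +_) (trans (∑∈-remove S g x∈S) (cong (g x +_) (∑∈-remove (S ∖ x) g y∈Sx)))) ⟩
            g a + (g x + (g y + ∑∈ (S ∖ x ∖ y) g))
              ≤⟨ +-mono-≤ ≤a (+-mono-≤ (≤heavy hx) (+-mono-≤ (≤heavy hy) (∑∈-mono (S ∖ x ∖ y) (λ {z} z∈ → weight-high m (d v z) (matched v) (matched z) (≤-losses D₃ z∈))))) ⟩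
            64 * Q + (4 * Q + (4 * Q + ∑∈ (S ∖ x ∖ y) (cap 3)))
              ≡⟨ solve 2 (λ q s → con 64 :* q :+ (con 4 :* q :+ (con 4 :* q :+ s)) := con 72 :* q :+ s) refl Q _ ⟩
            72 * Q + ∑∈ (S ∖ x ∖ y) (cap 3)               ∎)
          (capped-sum D₃ (d≤ v) m 0 refl) (≤ᵇ⇒≤ _ _ _)
          where
          open ≤-Reasoning
          open +-*-Solver
          y∈Sx : y ∈ S ∖ x
          y∈Sx = ∈-∖⁺ S y∈S y≢x
          loses-to-x : ∀ {z} → z ∈ S ∖ x → x ∈ loss v z
          loses-to-x {z} z∈ with z∈S , z≢x ← ∈-∖⁻ S z∈ with z ≟ y
          ... | no z≢y = two-heavy-dominate hx hy y≢x z∈S z≢x z≢y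
          -- Here `z` is `y` itself, which loses to `x` because `x` is its partner.
          ... | yes refl = proj₂ (∈-∩⁻ Y (loss v y) (p∈losses y∈S (two-heavy⇒partners hy hx (y≢x ∘ sym))))
          loses-to-y : ∀ {z} → z ∈ S ∖ x ∖ y → y ∈ loss v z
          loses-to-y z∈ with z∈Sx , z≢y ← ∈-∖⁻ (S ∖ x) z∈ with z∈S , z≢x ← ∈-∖⁻ S z∈Sx =
            two-heavy-dominate hy hx (y≢x ∘ sym) z∈S z≢y z≢x
          D₃ : Dominated (loss v) (d v) 3 (S ∖ x ∖ y)
          D₃ = peel (peel D₁ x∈S loses-to-x) y∈Sx loses-to-y

        F≤ : 72 * F ≤ 83 * 4 ^ (3 + m)
        F≤ = first (any? heavy?)
          where
          second : ∀ {x} → Heavy x → Dec (∃ λ y → Heavy y × y ≢ x) → 72 * F ≤ 83 * 4 ^ (3 + m)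
          second hx (yes (y , hy , y≢x)) = two-heavy hx hy y≢x
          second hx (no none)            = one-heavy hx (λ y≢x hy → none (_ , hy , y≢x))
          first : Dec (∃ Heavy) → 72 * F ≤ 83 * 4 ^ (3 + m)
          first (yes (x , hx)) = second hx (any? (λ y → heavy? y ×-dec ¬? (y ≟ x)))
          first (no none)      = no-heavy none

      -- The weight received by an unmatched vertex

      module Unmatched (none : ¬ ∃ (Partner v)) where

        v-unmatched : matched v ≡ false
        v-unmatched = dec-false (partner? v) none

        d≥1 : ∀ {x} → x ∈ R → 1 ≤ d v x
        d≥1 {x} x∈R with x∈Y , x≢v ← ∈-∖⁻ Y x∈R = n≢0⇒n>0 (λ d≡0 → none (x , x∈Y , x≢v , d≡0))

        -- The edges of deficit 1 whose other end hands over its half, so that `v` receives 32 units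
        -- instead of 16.
        Heavy : Fin m → Set
        Heavy u = u ∈ R × d v u ≡ 1 × u ∈ matched

        no-heavy : ¬ ∃ Heavy → 72 * F ≤ 83 * 4 ^ (3 + m)
        -- `44 = 8 * 3 + 4 * 5`: at most three edges have deficit at most 1 and at most five have
        -- deficit at most 2. Nothing is peeled, so the cap 2 is `J` itself and the exponent is
        -- `suc m`, which gives `68 = 17 * 4`.
        no-heavy ¬heavy = budget m 44 68 (begin
          F
            ≤⟨ ∑∈-mono R term ⟩
          ∑∈ R (λ x → cap 2 x + low 1 8 x + low 2 4 x)
            ≡⟨ trans (∑∈-+ R _ (low 2 4)) (cong (_+ ∑∈ R (low 2 4)) (∑∈-+ R (cap 2) (low 1 8))) ⟩
          ∑∈ R (cap 2) + ∑∈ R (low 1 8) + ∑∈ R (low 2 4)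
            ≤⟨ +-mono-≤ (+-monoʳ-≤ (∑∈ R (cap 2)) (low≤ 1 8)) (low≤ 2 4) ⟩
          ∑∈ R (cap 2) + 8 * Q * 3 + 4 * Q * 5
            ≡⟨ solve 2 (λ q s → s :+ con 8 :* q :* con 3 :+ con 4 :* q :* con 5 := con 44 :* q :+ s) refl Q _ ⟩
          44 * Q + ∑∈ R (cap 2) ∎)
          (≤-trans (capped-sum (star v) (d≤ v) (suc m) 2 refl) (≤-reflexive (solve 1 (λ q → con 17 :* (con 4 :* q) := con 68 :* q) refl Q)))
          (≤ᵇ⇒≤ _ _ _)
          where
          open ≤-Reasoning
          open +-*-Solver
          low : ℕ → ℕ → Fin m → ℕ
          low j c x = if d v x ≤ᵇ j then c * Q else 0
          low≤ : ∀ j c → ∑∈ R (low j c) ≤ c * Q * (2 * j + 1)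
          low≤ j c = ≤-trans (≤-reflexive (∑∈-filter R (λ x → d v x ≤ᵇ j) (c * Q))) (*-monoʳ-≤ (c * Q) (count-≤ (star v) j))
          term : ∀ {x} → x ∈ R → g x ≤ cap 2 x + low 1 8 x + low 2 4 x
          term {x} x∈R rewrite v-unmatched = weight-unmatched₁ m (d v x) (matched x) (d≥1 x∈R)
            (λ d≡1 → Bool.¬-not (λ mx → ¬heavy (x , x∈R , d≡1 , mx)))

        module _ {u : Fin m} (heavy : Heavy u) where

          private
            u∈R  = proj₁ heavy
            du≡1 = proj₁ (proj₂ heavy)
            u∈Y  = proj₁ (∈-∖⁻ Y u∈R)
            u≢v  = proj₂ (∈-∖⁻ Y u∈R)
            S    = R ∖ u

          -- The partner of `u` is not `v`, since the edge `vu` has deficit 1 rather than 0.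
          p∈losses : ∀ {p} → Partner u p → p ∈ Y ∩ loss v u
          p∈losses {p} up = loses-to-partner′ up v∈Y (u≢v ∘ sym) v≢p
            where
            v≢p : v ≢ p
            v≢p refl with () ← trans (sym du≡1) (proj₂ (proj₂ (partner-sym u∈Y up)))

          -- The one loss of vu is to the partner of u.
          heavy-dominates : ∀ {x} → x ∈ S → u ∈ loss v x
          heavy-dominates {x} x∈S with x∈R , x≢u ← ∈-∖⁻ R x∈S with x∈Y , x≢v ← ∈-∖⁻ Y x∈R
            with p , up ← partner (proj₂ (proj₂ heavy)) with loss-total x≢v u≢v x≢u
          ... | inj₁ u∈ = u∈
          ... | inj₂ x∈ with refl ← card≡1⇒≡ (Y ∩ loss v u) du≡1 (∈-∩⁺ Y (loss v u) x∈Y x∈) (p∈losses up)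
                = proj₂ (∈-∩⁻ Y (loss v x) (loses-to-partner′ (partner-sym u∈Y up) v∈Y (x≢v ∘ sym) (u≢v ∘ sym)))

          D₁ : Dominated (loss v) (d v) 1 S
          D₁ = peel (star v) u∈R heavy-dominates

          F≡ : F ≡ g u + ∑∈ S g
          F≡ = ∑∈-remove R g u∈R

          ≤32 : ∀ {x} → d v x ≡ 1 → g x ≤ 32 * Q
          ≤32 d≡1 = ≤-trans (≤2* 1 d≡1) (≤-reflexive (solve 1 (λ q → con 2 :* (con 4 :* (con 4 :* q)) := con 32 :* q) refl Q))
            where open +-*-Solver

          deficits-1 : (∀ {x} → x ∈ S → d v x ≢ 1) → 72 * F ≤ 83 * 4 ^ (3 + m)
          -- `53 = 32 + 7 * 3`: the heavy edge, and the excess of at most three edges of deficit 2.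
          deficits-1 d≢1 = budget m 53 17 (begin
            F                                              ≡⟨ F≡ ⟩
            g u + ∑∈ S g                                   ≤⟨ +-mono-≤ (≤32 du≡1) (∑∈-mono S term) ⟩
            32 * Q + ∑∈ S (λ x → cap 3 x + low x)
              ≡⟨ cong (32 * Q +_) (trans (∑∈-+ S (cap 3) low) (cong (∑∈ S (cap 3) +_) (∑∈-filter S (λ x → d v x ≤ᵇ 2) (7 * Q)))) ⟩
            32 * Q + (∑∈ S (cap 3) + 7 * Q * card (S ∩ (λ x → d v x ≤ᵇ 2)))
              ≤⟨ +-monoʳ-≤ (32 * Q) (+-monoʳ-≤ (∑∈ S (cap 3)) (*-monoʳ-≤ (7 * Q) (count-≤ D₁ 1))) ⟩
            32 * Q + (∑∈ S (cap 3) + 7 * Q * 3)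
              ≡⟨ solve 2 (λ q s → con 32 :* q :+ (s :+ con 7 :* q :* con 3) := con 53 :* q :+ s) refl Q _ ⟩
            53 * Q + ∑∈ S (cap 3)                          ∎)
            (capped-sum D₁ (d≤ v) m 2 refl) (≤ᵇ⇒≤ _ _ _)
            where
            open ≤-Reasoning
            open +-*-Solver
            low : Fin m → ℕ
            low x = if d v x ≤ᵇ 2 then 7 * Q else 0
            term : ∀ {x} → x ∈ S → g x ≤ cap 3 x + low x
            term {x} x∈S rewrite v-unmatched = weight-unmatched₂ m (d v x) (matched x)
              (≤∧≢⇒< (≤-losses D₁ x∈S) (d≢1 x∈S ∘ sym))

          module _ {w : Fin m} (w∈S : w ∈ S) (dw≡1 : d v w ≡ 1) where

            private S₂ = S ∖ w

            D₂ : Dominated (loss v) (d v) 2 S₂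
            D₂ = peel-minimal D₁ w∈S (≤-reflexive dw≡1)

            high : ∀ {T} → (∀ {x} → x ∈ T → 3 ≤ d v x) → ∑∈ T g ≤ ∑∈ T (cap 3)
            high {T} d≥3 = ∑∈-mono T (λ {x} x∈T → weight-high m (d v x) (matched v) (matched x) (d≥3 x∈T))

            F≤64 : F ≤ 64 * Q + ∑∈ S₂ g
            F≤64 = begin
              F                                ≡⟨ trans F≡ (cong (g u +_) (∑∈-remove S g w∈S)) ⟩
              g u + (g w + ∑∈ S₂ g)            ≤⟨ +-mono-≤ (≤32 du≡1) (+-monoˡ-≤ (∑∈ S₂ g) (≤32 dw≡1)) ⟩
              32 * Q + (32 * Q + ∑∈ S₂ g)
                ≡⟨ solve 2 (λ q s → con 32 :* q :+ (con 32 :* q :+ s) := con 64 :* q :+ s) refl Q _ ⟩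
              64 * Q + ∑∈ S₂ g                 ∎
              where
              open ≤-Reasoning
              open +-*-Solver

            deficits-1-1 : (∀ {x} → x ∈ S₂ → d v x ≢ 2) → 72 * F ≤ 83 * 4 ^ (3 + m)
            -- Two edges of at most 32 units each. With `u` and `w` peeled off, the cap 3 means
            -- `J = 1` and `6 * J + 5 = 11`.
            deficits-1-1 d≢2 = budget m 64 11
              (≤-trans F≤64 (+-monoʳ-≤ (64 * Q) (high (λ x∈ → ≤∧≢⇒< (≤-losses D₂ x∈) (d≢2 x∈ ∘ sym)))))
              (capped-sum D₂ (d≤ v) m 1 refl) (≤ᵇ⇒≤ _ _ _)

            deficits-1-1-2 : ∀ {x} → x ∈ S₂ → d v x ≡ 2 → 72 * F ≤ 83 * 4 ^ (3 + m)
            -- `72 = 32 + 32 + 8`. The deficits 1, 1, 2 allow three peelings, so every other deficit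
            -- is at least 3 and `J = 0`; this total is 5304 as well.
            deficits-1-1-2 {x} x∈ dx≡2 = budget m 72 5
              (begin
                F                                       ≤⟨ F≤64 ⟩
                64 * Q + ∑∈ S₂ g                        ≡⟨ cong (64 * Q +_) (∑∈-remove S₂ g x∈) ⟩
                64 * Q + (g x + ∑∈ (S₂ ∖ x) g)
                  ≤⟨ +-monoʳ-≤ (64 * Q) (+-mono-≤ (≤2* 2 dx≡2) (high (≤-losses D₃))) ⟩
                64 * Q + (2 * (4 * Q) + ∑∈ (S₂ ∖ x) (cap 3))
                  ≡⟨ solve 2 (λ q s → con 64 :* q :+ (con 2 :* (con 4 :* q) :+ s) := con 72 :* q :+ s) refl Q _ ⟩
                72 * Q + ∑∈ (S₂ ∖ x) (cap 3)            ∎)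
              (capped-sum D₃ (d≤ v) m 0 refl) (≤ᵇ⇒≤ _ _ _)
              where
              open ≤-Reasoning
              open +-*-Solver
              D₃ : Dominated (loss v) (d v) 3 (S₂ ∖ x)
              D₃ = peel-minimal D₂ x∈ (≤-reflexive dx≡2)

        F≤ : 72 * F ≤ 83 * 4 ^ (3 + m)
        F≤ = first (any? (λ u → (R u Bool.≟ true) ×-dec ((d v u ℕ.≟ 1) ×-dec (matched u Bool.≟ true))))
          where
          third : ∀ {u w} → (hu : Heavy u) (w∈ : w ∈ R ∖ u) → d v w ≡ 1 →
                  Dec (∃ λ x → x ∈ R ∖ u ∖ w × d v x ≡ 2) → 72 * F ≤ 83 * 4 ^ (3 + m)
          third hu w∈ dw≡1 (yes (_ , x∈ , dx≡2)) = deficits-1-1-2 hu w∈ dw≡1 x∈ dx≡2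
          third hu w∈ dw≡1 (no d≢2)              = deficits-1-1 hu w∈ dw≡1 (λ x∈ d≡2 → d≢2 (_ , x∈ , d≡2))
          second : ∀ {u} → Heavy u → Dec (∃ λ w → w ∈ R ∖ u × d v w ≡ 1) → 72 * F ≤ 83 * 4 ^ (3 + m)
          second {u} hu (yes (w , w∈ , dw≡1)) =
            third hu w∈ dw≡1 (any? (λ x → ((R ∖ u ∖ w) x Bool.≟ true) ×-dec (d v x ℕ.≟ 2)))
          second hu (no d≢1) = deficits-1 hu (λ x∈ d≡1 → d≢1 (_ , x∈ , d≡1))
          first : Dec (∃ Heavy) → 72 * F ≤ 83 * 4 ^ (3 + m)
          first (yes (u , hu)) = second hu (any? (λ w → ((R ∖ u) w Bool.≟ true) ×-dec (d v w ℕ.≟ 1)))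
          first (no ¬heavy)    = no-heavy ¬heavy

      vertex-bound : 72 * F ≤ 83 * 4 ^ (3 + m)
      vertex-bound = by-cases (partner? v)
        where
        by-cases : Dec (∃ (Partner v)) → 72 * F ≤ 83 * 4 ^ (3 + m)
        by-cases (yes (a , va)) = Matched.F≤ va
        by-cases (no none)      = Unmatched.F≤ none

-- Averaging over all vertex subsets

ι : Bool → ℕ
ι b = if b then 1 else 0

does-≟-sym : (x y : Fin m) → does (x ≟ y) ≡ does (y ≟ x)
does-≟-sym x y with y ≟ x
... | yes refl = dec-true (x ≟ x) refl
... | no  y≢x  = dec-false (x ≟ y) (y≢x ∘ sym)

sum-const : ∀ m c → sum {m} (λ _ → c) ≡ m * c
sum-const zero    c = refl
sum-const (suc m) c = cong (c +_) (sum-const m c)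

∑≢ : (Fin m → Fin m → ℕ) → ℕ
∑≢ f = sum (λ v → sum (λ x → if does (x ≟ v) then 0 else f v x))

∑≢-cong : {f g : Fin m → Fin m → ℕ} → (∀ {v x} → x ≢ v → f v x ≡ g v x) → ∑≢ f ≡ ∑≢ g
∑≢-cong {f = f} {g} f≡g = sum-cong-≗ λ v → sum-cong-≗ λ x → term v x
  where
  term : ∀ v x → (if does (x ≟ v) then 0 else f v x) ≡ (if does (x ≟ v) then 0 else g v x)
  term v x with x ≟ v
  ... | yes _  = refl
  ... | no x≢v = f≡g x≢v

∑≢-* : (c : ℕ) (f : Fin m → Fin m → ℕ) → ∑≢ (λ v x → c * f v x) ≡ c * ∑≢ f
∑≢-* c f = trans (sum-cong-≗ (λ v → trans (sum-cong-≗ (λ x → term (does (x ≟ v)) (f v x))) (sym (*-distribˡ-sum c (λ x → if does (x ≟ v) then 0 else f v x)))))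
                 (sym (*-distribˡ-sum c (λ v → sum (λ x → if does (x ≟ v) then 0 else f v x))))
  where
  term : ∀ b k → (if b then 0 else c * k) ≡ c * (if b then 0 else k)
  term true  k = sym (*-zeroʳ c)
  term false k = refl

∑≢-symmetrise : (f : Fin m → Fin m → ℕ) → ∑≢ (λ v x → f v x + f x v) ≡ 2 * ∑≢ f
∑≢-symmetrise {m} f = begin
  ∑≢ (λ v x → f v x + f x v)
    ≡⟨ sum-cong-≗ (λ v → trans (sum-cong-≗ (λ x → split (does (x ≟ v)))) (∑-distrib-+ (λ x → if does (x ≟ v) then 0 else f v x) (λ x → if does (x ≟ v) then 0 else f x v))) ⟩
  sum (λ v → sum (λ x → if does (x ≟ v) then 0 else f v x) + sum (λ x → if does (x ≟ v) then 0 else f x v))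
    ≡⟨ ∑-distrib-+ (λ v → sum (λ x → if does (x ≟ v) then 0 else f v x)) (λ v → sum (λ x → if does (x ≟ v) then 0 else f x v)) ⟩
  ∑≢ f + sum (λ v → sum (λ x → if does (x ≟ v) then 0 else f x v))
    ≡⟨ cong (∑≢ f +_) (∑-comm {m} {m} (λ v x → if does (x ≟ v) then 0 else f x v)) ⟩
  ∑≢ f + sum (λ x → sum (λ v → if does (x ≟ v) then 0 else f x v))
    ≡⟨ cong (∑≢ f +_) (sum-cong-≗ (λ x → sum-cong-≗ (λ v → cong (if_then 0 else f x v) (does-≟-sym x v)))) ⟩
  ∑≢ f + ∑≢ f
    ≡⟨ cong (∑≢ f +_) (+-identityʳ _) ⟨
  2 * ∑≢ f ∎
  where
  open ≡-Reasoning
  split : ∀ b {j k} → (if b then 0 else j + k) ≡ (if b then 0 else j) + (if b then 0 else k)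
  split true  = refl
  split false = refl

-- Membership becomes a pair of indicator factors, so that a sum over all `Y` can later be factored
-- vertex by vertex.
∑∈-pairs : (Y : Subset m) (f : Fin m → Fin m → ℕ) →
           ∑∈ Y (λ v → ∑∈ (Y ∖ v) (f v)) ≡ ∑≢ (λ v x → f v x * ι (Y v) * ι (Y x))
∑∈-pairs {m} Y f = sum-cong-≗ (λ v → trans (if-sum (Y v) (λ x → if (Y ∖ v) x then f v x else 0))
                                       (sum-cong-≗ (λ x → term (Y v) (Y x) (does (x ≟ v)) (f v x))))
  where
  term : ∀ a b e k → (if a then (if b ∧ not e then k else 0) else 0) ≡ (if e then 0 else k * ι a * ι b)
  term true  true  true  k = refl
  term true  true  false k = sym (trans (*-identityʳ _) (*-identityʳ k))
  term true  false true  k = refl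
  term true  false false k = sym (*-zeroʳ (k * 1))
  term false _     true  k = refl
  term false b     false k rewrite *-zeroʳ k = refl

product-const : ∀ m c → product {m} (λ _ → c) ≡ c ^ m
product-const zero    c = refl
product-const (suc m) c = cong (c *_) (product-const m c)

-- Spreads a factor attached to one vertex over a product ranging over all vertices, where it can be
-- merged with others.
product-at : (v : Fin m) (k : Fin m → ℕ) → product (λ z → if does (z ≟ v) then k z else 1) ≡ k v
product-at {suc m} zero    k = trans (cong (k zero *_) (trans (product-const m 1) (^-zeroˡ m))) (*-identityʳ _)
product-at (suc v) k = trans (+-identityʳ _) (product-at v (k ∘ suc))

product-card : (S : Subset m) (c : ℕ) → product (λ z → if S z then c else 1) ≡ c ^ card S
product-card {zero}  S c = refl
product-card {suc m} S c with S zero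
... | true  = cong (c *_) (product-card (S ∘ suc) c)
... | false = trans (+-identityʳ _) (product-card (S ∘ suc) c)

product-* : (f g : Fin m → ℕ) → product f * product g ≡ product (λ z → f z * g z)
product-* f g = sym (product-distrib-* f g)

-- Sums over all subsets

∑⊆ : (Subset m → ℕ) → ℕ
∑⊆ {zero}  F = F (λ ())
∑⊆ {suc m} F = ∑⊆ (λ Y → F (false ∷ Y)) + ∑⊆ (λ Y → F (true ∷ Y))

∑⊆-mono : {F G : Subset m → ℕ} → (∀ Y → F Y ≤ G Y) → ∑⊆ F ≤ ∑⊆ G
∑⊆-mono {zero}  F≤G = F≤G _
∑⊆-mono {suc m} F≤G = +-mono-≤ (∑⊆-mono (λ Y → F≤G (false ∷ Y))) (∑⊆-mono (λ Y → F≤G (true ∷ Y)))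

∑⊆-cong : {F G : Subset m → ℕ} → (∀ Y → F Y ≡ G Y) → ∑⊆ F ≡ ∑⊆ G
∑⊆-cong {zero}  F≡G = F≡G _
∑⊆-cong {suc m} F≡G = cong₂ _+_ (∑⊆-cong (λ Y → F≡G (false ∷ Y))) (∑⊆-cong (λ Y → F≡G (true ∷ Y)))

∑⊆-+ : (F G : Subset m → ℕ) → ∑⊆ (λ Y → F Y + G Y) ≡ ∑⊆ F + ∑⊆ G
∑⊆-+ {zero}  F G = refl
∑⊆-+ {suc m} F G = trans (cong₂ _+_ (∑⊆-+ (λ Y → F (false ∷ Y)) _) (∑⊆-+ (λ Y → F (true ∷ Y)) _))
  (solve 4 (λ a b c d → (a :+ b) :+ (c :+ d) := (a :+ c) :+ (b :+ d)) refl (∑⊆ (λ Y → F (false ∷ Y))) _ _ _)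
  where open +-*-Solver

∑⊆-* : (c : ℕ) (F : Subset m → ℕ) → ∑⊆ (λ Y → c * F Y) ≡ c * ∑⊆ F
∑⊆-* {zero}  c F = refl
∑⊆-* {suc m} c F = trans (cong₂ _+_ (∑⊆-* c (λ Y → F (false ∷ Y))) (∑⊆-* c (λ Y → F (true ∷ Y)))) (sym (*-distribˡ-+ c _ _))

∑⊆-zero : ∀ m → ∑⊆ {m} (λ _ → 0) ≡ 0
∑⊆-zero zero = refl
∑⊆-zero (suc m) rewrite ∑⊆-zero m = refl

∑⊆-sum : ∀ {n} (F : Fin n → Subset m → ℕ) → ∑⊆ (λ Y → sum (λ v → F v Y)) ≡ sum (λ v → ∑⊆ (F v))
∑⊆-sum {m} {zero}  F = ∑⊆-zero m
∑⊆-sum {m} {suc n} F = trans (∑⊆-+ (F zero) (λ Y → sum (λ v → F (suc v) Y))) (cong (∑⊆ (F zero) +_) (∑⊆-sum (F ∘ suc)))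

∑⊆-∑≢ : (F : Fin m → Fin m → Subset m → ℕ) → ∑⊆ (λ Y → ∑≢ (λ v x → F v x Y)) ≡ ∑≢ (λ v x → ∑⊆ (F v x))
∑⊆-∑≢ {m} F = trans (∑⊆-sum (λ v Y → sum (λ x → if does (x ≟ v) then 0 else F v x Y)))
  (sum-cong-≗ (λ v → trans (∑⊆-sum (λ x Y → if does (x ≟ v) then 0 else F v x Y)) (sum-cong-≗ (λ x → term (does (x ≟ v))))))
  where
  term : ∀ b {v x} → ∑⊆ (λ Y → if b then 0 else F v x Y) ≡ (if b then 0 else ∑⊆ (F v x))
  term true  = ∑⊆-zero m
  term false = refl

-- Independence of the vertices: expanding the right-hand product picks, for each vertex, whether it
-- lies in `Y`.
∑⊆-product : (g : Fin m → Bool → ℕ) → ∑⊆ (λ Y → product (λ z → g z (Y z))) ≡ product (λ z → g z false + g z true)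
∑⊆-product {zero}  g = refl
∑⊆-product {suc m} g = begin
  ∑⊆ (λ Y → g zero false * P Y) + ∑⊆ (λ Y → g zero true * P Y)
    ≡⟨ cong₂ _+_ (∑⊆-* (g zero false) P) (∑⊆-* (g zero true) P) ⟩
  g zero false * ∑⊆ P + g zero true * ∑⊆ P
    ≡⟨ *-distribʳ-+ (∑⊆ P) (g zero false) (g zero true) ⟨
  (g zero false + g zero true) * ∑⊆ P
    ≡⟨ cong ((g zero false + g zero true) *_) (∑⊆-product (g ∘ suc)) ⟩
  product (λ z → g z false + g z true)                         ∎
  where
  open ≡-Reasoning
  P : Subset m → ℕ
  P Y = product (λ z → g (suc z) (Y z))

-- The unnormalised expectation over a random vertex set

module Averaging {m : ℕ} (W : Fin m → Fin m → Subset m)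
  (W-sym : ∀ x y z → W x y z ≡ W y x z)
  (W-excl : ∀ {x y z} → y ≢ x → z ≢ x → y ≢ z → W x y z ≡ true → W x z y ≡ false)
  (W-degenerate : ∀ x y → W x y y ≡ false)
  where

  open Graph W W-sym W-excl

  -- Redistribution keeps the total, so the bounds at the single vertices add up. The totals are
  -- compared after doubling, because only the two shares of an edge together equal twice its
  -- weight.
  induced-bound : ∀ Y → (let open Induced Y) →
    72 * ∑∈ Y (λ v → ∑∈ (Y ∖ v) (λ x → 4 ^ (3 + m ∸ d v x))) ≤ 83 * 4 ^ (3 + m) * card Y
  induced-bound Y = begin
    72 * ∑∈ Y (λ v → ∑∈ (Y ∖ v) (e v))
      ≡⟨ cong (72 *_) (*-cancelˡ-≡ (∑∈ Y (λ v → ∑∈ (Y ∖ v) (e v))) (∑∈ Y (λ v → ∑∈ (Y ∖ v) (share-of v))) 2 redistribute) ⟩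
    72 * ∑∈ Y (λ v → ∑∈ (Y ∖ v) (share-of v))      ≡⟨ ∑∈-* Y 72 _ ⟨
    ∑∈ Y (λ v → 72 * ∑∈ (Y ∖ v) (share-of v))      ≤⟨ ∑∈-mono Y (λ v∈Y → Vertex.vertex-bound v∈Y) ⟩
    ∑∈ Y (λ v → 83 * 4 ^ (3 + m))                  ≡⟨ ∑∈-const Y _ ⟩
    83 * 4 ^ (3 + m) * card Y                      ∎
    where
    open ≤-Reasoning
    open Induced Y
    e : Fin m → Fin m → ℕ
    e v x = 4 ^ (3 + m ∸ d v x)
    split : ∀ v x → share-of v x * ι (Y v) * ι (Y x) + share-of x v * ι (Y x) * ι (Y v) ≡ 2 * (e v x * ι (Y v) * ι (Y x))
    split v x = begin-equality
      share-of v x * ι (Y v) * ι (Y x) + share-of x v * ι (Y x) * ι (Y v)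
        ≡⟨ solve 4 (λ p q a b → p :* a :* b :+ q :* b :* a := (p :+ q) :* a :* b) refl (share-of v x) (share-of x v) (ι (Y v)) (ι (Y x)) ⟩
      (share-of v x + share-of x v) * ι (Y v) * ι (Y x)
        ≡⟨ cong (λ k → (share-of v x + weight m k (matched x) (matched v)) * ι (Y v) * ι (Y x)) (d-sym x v) ⟩
      (share-of v x + weight m (d v x) (matched x) (matched v)) * ι (Y v) * ι (Y x)
        ≡⟨ cong (λ k → k * ι (Y v) * ι (Y x)) (weight-split m (d v x) (matched v) (matched x)) ⟩
      2 * e v x * ι (Y v) * ι (Y x)
        ≡⟨ solve 3 (λ p a b → con 2 :* p :* a :* b := con 2 :* (p :* a :* b)) refl (e v x) (ι (Y v)) (ι (Y x)) ⟩
      2 * (e v x * ι (Y v) * ι (Y x)) ∎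
      where open +-*-Solver
    redistribute : 2 * ∑∈ Y (λ v → ∑∈ (Y ∖ v) (e v)) ≡ 2 * ∑∈ Y (λ v → ∑∈ (Y ∖ v) (share-of v))
    redistribute = begin-equality
      2 * ∑∈ Y (λ v → ∑∈ (Y ∖ v) (e v))                 ≡⟨ cong (2 *_) (∑∈-pairs Y e) ⟩
      2 * ∑≢ (λ v x → e v x * ι (Y v) * ι (Y x))        ≡⟨ ∑≢-* 2 (λ v x → e v x * ι (Y v) * ι (Y x)) ⟨
      ∑≢ (λ v x → 2 * (e v x * ι (Y v) * ι (Y x)))      ≡⟨ ∑≢-cong (λ {v} {x} _ → split v x) ⟨
      ∑≢ (λ v x → share-of v x * ι (Y v) * ι (Y x) + share-of x v * ι (Y x) * ι (Y v))
        ≡⟨ ∑≢-symmetrise (λ v x → share-of v x * ι (Y v) * ι (Y x)) ⟩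
      2 * ∑≢ (λ v x → share-of v x * ι (Y v) * ι (Y x)) ≡⟨ cong (2 *_) (∑∈-pairs Y share-of) ⟨
      2 * ∑∈ Y (λ v → ∑∈ (Y ∖ v) (share-of v))          ∎

  -- The product over z of cell v x z is 2^(m-|Y|) · 4^(|Y|-d), i.e. (up to scaling) the
  -- weight (1/4)^d times the probability of Y.
  cell : Fin m → Fin m → Fin m → Bool → ℕ
  cell v x z b = if b then (if loss v x z then 1 else 4) else 2

  pairWeight : Fin m → Fin m → Subset m → ℕ
  pairWeight v x Y = product (λ z → cell v x z (Y z))

  -- `inside Y` is the probability of `Y` times `6 ^ m`, as 4 to 2 is the ratio of 2/3 to 1/3.
  -- `outside Y` is the cofactor that completes it to `4 ^ m` for every `Y`.
  inside outside : Subset m → ℕ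
  inside  Y = product (λ z → if Y z then 4 else 2)
  outside Y = product (λ z → if Y z then 1 else 2)

  inside*outside : ∀ Y → inside Y * outside Y ≡ 4 ^ m
  inside*outside Y = trans (product-* (λ z → if Y z then 4 else 2) (λ z → if Y z then 1 else 2))
    (trans (product-cong-≗ (λ z → term (Y z))) (product-const m 4))
    where
    term : ∀ b → (if b then 4 else 2) * (if b then 1 else 2) ≡ 4
    term true  = refl
    term false = refl

  pairWeight-outside : ∀ v x Y → 64 * outside Y * pairWeight v x Y ≡ 4 ^ (3 + m ∸ Induced.d Y v x)
  pairWeight-outside v x Y = *-cancelʳ-≡ _ _ (4 ^ k) {{m^n≢0 4 k}} (begin
    64 * outside Y * pairWeight v x Y * 4 ^ k
      ≡⟨ solve 3 (λ o p q → con 64 :* o :* p :* q := con 64 :* (p :* q :* o)) refl (outside Y) (pairWeight v x Y) (4 ^ k) ⟩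
    64 * (pairWeight v x Y * 4 ^ k * outside Y)   ≡⟨ cong (64 *_) four ⟩
    64 * 4 ^ m
      ≡⟨ solve 1 (λ q → con 64 :* q := con 4 :* (con 4 :* (con 4 :* q))) refl (4 ^ m) ⟩
    4 ^ (3 + m)                                   ≡⟨ cong (4 ^_) (m∸n+n≡m (d≤ v x)) ⟨
    4 ^ (3 + m ∸ k + k)                           ≡⟨ ^-distribˡ-+-* 4 (3 + m ∸ k) k ⟩
    4 ^ (3 + m ∸ k) * 4 ^ k                       ∎)
    where
    open ≡-Reasoning
    open +-*-Solver
    open Induced Y
    k = d v x
    -- The identity holds factor by factor: each vertex contributes 4 in all three cases.
    term : ∀ b l → (if b then (if l then 1 else 4) else 2) * (if b ∧ l then 4 else 1) * (if b then 1 else 2) ≡ 4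
    term true  true  = refl
    term true  false = refl
    term false l     = refl
    four : pairWeight v x Y * 4 ^ k * outside Y ≡ 4 ^ m
    four = begin
      pairWeight v x Y * 4 ^ k * outside Y
        ≡⟨ cong (λ p → pairWeight v x Y * p * outside Y) (product-card (Y ∩ loss v x) 4) ⟨
      pairWeight v x Y * product (λ z → if Y z ∧ loss v x z then 4 else 1) * outside Y
        ≡⟨ cong (_* outside Y) (product-* (λ z → cell v x z (Y z)) (λ z → if Y z ∧ loss v x z then 4 else 1)) ⟩
      product (λ z → cell v x z (Y z) * (if Y z ∧ loss v x z then 4 else 1)) * outside Y
        ≡⟨ product-* (λ z → cell v x z (Y z) * (if Y z ∧ loss v x z then 4 else 1)) (λ z → if Y z then 1 else 2) ⟩
      product (λ z → cell v x z (Y z) * (if Y z ∧ loss v x z then 4 else 1) * (if Y z then 1 else 2))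
        ≡⟨ product-cong-≗ (λ z → term (Y z) (loss v x z)) ⟩
      product {m} (λ _ → 4)
        ≡⟨ product-const m 4 ⟩
      4 ^ m ∎

  -- This is `induced-bound` weighted by the probability of `Y`; the conversion factor
  -- `64 * outside Y` is positive and cancels.
  weighted-bound : ∀ Y → 72 * ∑≢ (λ v x → pairWeight v x Y * ι (Y v) * ι (Y x)) ≤ 83 * (card Y * inside Y)
  weighted-bound Y = *-cancelˡ-≤ c {{c≢0}} (begin
    c * (72 * ∑≢ p)
      ≡⟨ solve 2 (λ c s → c :* (con 72 :* s) := con 72 :* (c :* s)) refl c (∑≢ p) ⟩
    72 * (c * ∑≢ p)                                    ≡⟨ cong (72 *_) (∑≢-* c p) ⟨
    72 * ∑≢ (λ v x → c * p v x)                        ≡⟨ cong (72 *_) (∑≢-cong (λ {v} {x} _ → absorb v x)) ⟩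
    72 * ∑≢ (λ v x → 4 ^ (3 + m ∸ d v x) * ι (Y v) * ι (Y x))
      ≡⟨ cong (72 *_) (∑∈-pairs Y (λ v x → 4 ^ (3 + m ∸ d v x))) ⟨
    72 * ∑∈ Y (λ v → ∑∈ (Y ∖ v) (λ x → 4 ^ (3 + m ∸ d v x))) ≤⟨ induced-bound Y ⟩
    83 * 4 ^ (3 + m) * card Y
      ≡⟨ cong (λ q → 83 * (4 * (4 * (4 * q))) * card Y) (inside*outside Y) ⟨
    83 * (4 * (4 * (4 * (inside Y * outside Y)))) * card Y
      ≡⟨ solve 3 (λ i o n → con 83 :* (con 4 :* (con 4 :* (con 4 :* (i :* o)))) :* n := con 64 :* o :* (con 83 :* (n :* i))) refl (inside Y) (outside Y) (card Y) ⟩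
    c * (83 * (card Y * inside Y))                     ∎)
    where
    open ≤-Reasoning
    open +-*-Solver
    open Induced Y using (d)
    c = 64 * outside Y
    p : Fin m → Fin m → ℕ
    p v x = pairWeight v x Y * ι (Y v) * ι (Y x)
    c≢0 : NonZero c
    c≢0 = m*n≢0 64 (outside Y) {{_}} {{m*n≢0⇒n≢0 (inside Y) {{subst NonZero (sym (inside*outside Y)) (m^n≢0 4 m)}}}}
    absorb : ∀ v x → c * p v x ≡ 4 ^ (3 + m ∸ d v x) * ι (Y v) * ι (Y x)
    absorb v x = trans (solve 4 (λ c q a b → c :* (q :* a :* b) := c :* q :* a :* b) refl c (pairWeight v x Y) (ι (Y v)) (ι (Y x)))
                       (cong (λ k → k * ι (Y v) * ι (Y x)) (pairWeight-outside v x Y))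

  -- The vertex `v` contributes 4 and every other vertex `2 + 4 = 6`. The extra 6 on the left avoids
  -- the exponent `m - 1`.
  ∑⊆-inside : ∀ v → 6 * ∑⊆ (λ Y → inside Y * ι (Y v)) ≡ 4 * 6 ^ m
  ∑⊆-inside v = begin
    6 * ∑⊆ (λ Y → inside Y * ι (Y v))
      ≡⟨ cong (6 *_) (trans (∑⊆-cong expand) (∑⊆-product (λ z b → (if b then 4 else 2) * at z (ι b)))) ⟩
    6 * product G
      ≡⟨ cong (_* product G) (product-at v (λ _ → 6)) ⟨
    product (λ z → at z 6) * product G
      ≡⟨ product-* (λ z → at z 6) G ⟩
    product (λ z → at z 6 * G z)
      ≡⟨ product-cong-≗ (λ z → term (does (z ≟ v))) ⟩
    product (λ z → at z 4 * 6)
      ≡⟨ product-* (λ z → at z 4) (λ _ → 6) ⟨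
    product (λ z → at z 4) * product {m} (λ _ → 6)
      ≡⟨ cong₂ _*_ (product-at v (λ _ → 4)) (product-const m 6) ⟩
    4 * 6 ^ m ∎
    where
    open ≡-Reasoning
    at : Fin m → ℕ → ℕ
    at z k = if does (z ≟ v) then k else 1
    G : Fin m → ℕ
    G z = 2 * at z 0 + 4 * at z 1
    expand : ∀ Y → inside Y * ι (Y v) ≡ product (λ z → (if Y z then 4 else 2) * at z (ι (Y z)))
    expand Y = trans (cong (inside Y *_) (sym (product-at v (ι ∘ Y)))) (product-* (λ z → if Y z then 4 else 2) (λ z → at z (ι (Y z))))
    term : ∀ b → (if b then 6 else 1) * (2 * (if b then 0 else 1) + 4 * (if b then 1 else 1)) ≡ (if b then 4 else 1) * 6
    term true  = refl
    term false = refl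

  ∑⊆-card*inside : 6 * ∑⊆ (λ Y → card Y * inside Y) ≡ m * (4 * 6 ^ m)
  ∑⊆-card*inside = begin
    6 * ∑⊆ (λ Y → card Y * inside Y)
      ≡⟨ cong (6 *_) (trans (∑⊆-cong (λ Y → trans (*-comm (card Y) (inside Y)) (*-distribˡ-sum (inside Y) (λ v → ι (Y v))))) (∑⊆-sum (λ v Y → inside Y * ι (Y v)))) ⟩
    6 * sum (λ v → ∑⊆ (λ Y → inside Y * ι (Y v)))
      ≡⟨ *-distribˡ-sum 6 (λ v → ∑⊆ (λ Y → inside Y * ι (Y v))) ⟩
    sum (λ v → 6 * ∑⊆ (λ Y → inside Y * ι (Y v)))
      ≡⟨ sum-cong-≗ ∑⊆-inside ⟩
    sum {m} (λ _ → 4 * 6 ^ m)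
      ≡⟨ sum-const m (4 * 6 ^ m) ⟩
    m * (4 * 6 ^ m) ∎
    where open ≡-Reasoning

  -- The vertices `v` and `x` contribute 4 each. Any other vertex contributes `2 + 1 = 3` at a loss
  -- and `2 + 4 = 6` otherwise, which is how probability 2/3 turns 1/4 into 1/2. The 9 makes up for
  -- `3 ^ (m - 2)`.
  ∑⊆-pairWeight : ∀ {v x} → x ≢ v →
    9 * ∑⊆ (λ Y → pairWeight v x Y * ι (Y v) * ι (Y x)) ≡ 16 * 3 ^ m * 2 ^ card (W v x)
  ∑⊆-pairWeight {v} {x} x≢v = begin
    9 * ∑⊆ (λ Y → pairWeight v x Y * ι (Y v) * ι (Y x))
      ≡⟨ cong (9 *_) (trans (∑⊆-cong expand) (∑⊆-product (λ z b → cell v x z b * at v z (ι b) * at x z (ι b)))) ⟩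
    9 * product G
      ≡⟨ trans (*-assoc 3 3 (product G)) (sym (cong₂ (λ a b → a * (b * product G)) (product-at v (λ _ → 3)) (product-at x (λ _ → 3)))) ⟩
    product (λ z → at v z 3) * (product (λ z → at x z 3) * product G)
      ≡⟨ trans (cong (product (λ z → at v z 3) *_) (product-* (λ z → at x z 3) G)) (product-* (λ z → at v z 3) (λ z → at x z 3 * G z)) ⟩
    product (λ z → at v z 3 * (at x z 3 * G z))
      ≡⟨ product-cong-≗ term ⟩
    product (λ z → at v z 4 * at x z 4 * 3 * (if W v x z then 2 else 1))
      ≡⟨ product-* (λ z → at v z 4 * at x z 4 * 3) (λ z → if W v x z then 2 else 1) ⟨
    product (λ z → at v z 4 * at x z 4 * 3) * product (λ z → if W v x z then 2 else 1)
      ≡⟨ cong₂ _*_ (trans (sym (product-* (λ z → at v z 4 * at x z 4) (λ _ → 3)))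
                          (cong₂ _*_ (trans (sym (product-* (λ z → at v z 4) (λ z → at x z 4))) (cong₂ _*_ (product-at v (λ _ → 4)) (product-at x (λ _ → 4)))) (product-const m 3)))
                   (product-card (W v x) 2) ⟩
    16 * 3 ^ m * 2 ^ card (W v x) ∎
    where
    open ≡-Reasoning
    at : Fin m → Fin m → ℕ → ℕ
    at y z k = if does (z ≟ y) then k else 1
    G : Fin m → ℕ
    G z = 2 * at v z 0 * at x z 0 + (if loss v x z then 1 else 4) * at v z 1 * at x z 1
    expand : ∀ Y → pairWeight v x Y * ι (Y v) * ι (Y x) ≡ product (λ z → cell v x z (Y z) * at v z (ι (Y z)) * at x z (ι (Y z)))
    expand Y = begin
      pairWeight v x Y * ι (Y v) * ι (Y x)
        ≡⟨ cong₂ (λ a b → pairWeight v x Y * a * b) (product-at v (ι ∘ Y)) (product-at x (ι ∘ Y)) ⟨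
      pairWeight v x Y * product (λ z → at v z (ι (Y z))) * product (λ z → at x z (ι (Y z)))
        ≡⟨ cong (_* product (λ z → at x z (ι (Y z)))) (product-* (λ z → cell v x z (Y z)) (λ z → at v z (ι (Y z)))) ⟩
      product (λ z → cell v x z (Y z) * at v z (ι (Y z))) * product (λ z → at x z (ι (Y z)))
        ≡⟨ product-* (λ z → cell v x z (Y z) * at v z (ι (Y z))) (λ z → at x z (ι (Y z))) ⟩
      product (λ z → cell v x z (Y z) * at v z (ι (Y z)) * at x z (ι (Y z))) ∎
    term : ∀ z → at v z 3 * (at x z 3 * G z) ≡ at v z 4 * at x z 4 * 3 * (if W v x z then 2 else 1)
    term z with z ≟ v | z ≟ x
    ... | yes refl | yes refl = contradiction refl x≢v
    ... | yes refl | no _ rewrite W-sym v x v | W-degenerate x v = refl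
    ... | no _     | yes refl rewrite W-degenerate v x = refl
    ... | no _     | no _ with W v x z
    ...   | true  = refl
    ...   | false = refl

  pair-sum-bound : 192 * ∑≢ (λ v x → 2 ^ card (W v x)) ≤ 83 * m * 2 ^ m
  -- `48 * 9 = 6 * 72` matches the two normalisations, `48 * 16 = 4 * 192` yields the constant, and
  -- `6 ^ m = 3 ^ m * 2 ^ m` frees the factor to cancel.
  pair-sum-bound = *-cancelˡ-≤ (4 * 3 ^ m) {{m*n≢0 4 (3 ^ m) {{_}} {{m^n≢0 3 m}}}} (begin
    4 * 3 ^ m * (192 * ∑≢ w)
      ≡⟨ solve 2 (λ t w → con 4 :* t :* (con 192 :* w) := con 48 :* (con 16 :* t :* w)) refl (3 ^ m) (∑≢ w) ⟩
    48 * (16 * 3 ^ m * ∑≢ w)                       ≡⟨ cong (48 *_) nine ⟨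
    48 * (9 * ∑⊆ P)
      ≡⟨ trans (sym (*-assoc 48 9 (∑⊆ P))) (*-assoc 6 72 (∑⊆ P)) ⟩
    6 * (72 * ∑⊆ P)                                ≡⟨ cong (6 *_) (∑⊆-* 72 P) ⟨
    6 * ∑⊆ (λ Y → 72 * P Y)                        ≤⟨ *-monoʳ-≤ 6 (∑⊆-mono weighted-bound) ⟩
    6 * ∑⊆ (λ Y → 83 * (card Y * inside Y))        ≡⟨ cong (6 *_) (∑⊆-* 83 (λ Y → card Y * inside Y)) ⟩
    6 * (83 * ∑⊆ (λ Y → card Y * inside Y))
      ≡⟨ solve 1 (λ s → con 6 :* (con 83 :* s) := con 83 :* (con 6 :* s)) refl (∑⊆ (λ Y → card Y * inside Y)) ⟩
    83 * (6 * ∑⊆ (λ Y → card Y * inside Y))        ≡⟨ cong (83 *_) ∑⊆-card*inside ⟩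
    83 * (m * (4 * 6 ^ m))                         ≡⟨ cong (λ k → 83 * (m * (4 * k))) six ⟩
    83 * (m * (4 * (3 ^ m * 2 ^ m)))
      ≡⟨ solve 3 (λ m t u → con 83 :* (m :* (con 4 :* (t :* u))) := con 4 :* t :* (con 83 :* m :* u)) refl m (3 ^ m) (2 ^ m) ⟩
    4 * 3 ^ m * (83 * m * 2 ^ m)                   ∎)
    where
    open ≤-Reasoning
    open +-*-Solver
    six : 6 ^ m ≡ 3 ^ m * 2 ^ m
    six = trans (sym (product-const m 6))
      (trans (sym (product-* {m} (λ _ → 3) (λ _ → 2))) (cong₂ _*_ (product-const m 3) (product-const m 2)))
    w : Fin m → Fin m → ℕ
    w v x = 2 ^ card (W v x)
    P : Subset m → ℕ
    P Y = ∑≢ (λ v x → pairWeight v x Y * ι (Y v) * ι (Y x))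
    nine : 9 * ∑⊆ P ≡ 16 * 3 ^ m * ∑≢ w
    nine = begin-equality
      9 * ∑⊆ P
        ≡⟨ cong (9 *_) (∑⊆-∑≢ (λ v x Y → pairWeight v x Y * ι (Y v) * ι (Y x))) ⟩
      9 * ∑≢ (λ v x → ∑⊆ (λ Y → pairWeight v x Y * ι (Y v) * ι (Y x)))
        ≡⟨ ∑≢-* 9 (λ v x → ∑⊆ (λ Y → pairWeight v x Y * ι (Y v) * ι (Y x))) ⟨
      ∑≢ (λ v x → 9 * ∑⊆ (λ Y → pairWeight v x Y * ι (Y v) * ι (Y x)))
        ≡⟨ ∑≢-cong ∑⊆-pairWeight ⟩
      ∑≢ (λ v x → 16 * 3 ^ m * w v x)
        ≡⟨ ∑≢-* (16 * 3 ^ m) w ⟩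
      16 * 3 ^ m * ∑≢ w ∎

-- Multiplicities of a triangular choice multigraph

list-sum-allFin : ∀ m (f : Fin m → ℕ) → List.sum (map f (allFin m)) ≡ sum f
list-sum-allFin m f = trans (cong List.sum (map-tabulate id f)) (sum-tabulate m f)
  where
  sum-tabulate : ∀ n (g : Fin n → ℕ) → List.sum (tabulate g) ≡ sum g
  sum-tabulate zero    g = refl
  sum-tabulate (suc n) g = cong (g zero +_) (sum-tabulate n (g ∘ suc))

-- The helper functions of Defs are private; these expose them as the solutions of
-- definitional equations.
multTerm : (c : TCM m) (x y : Fin m) (x<y : toℕ x < toℕ y) →
           ∃ λ (f : Fin m → ℕ) → mult c x y x<y ≡ List.sum (map f (allFin m))
multTerm c x y x<y = _ , refl

w2Term : (c : TCM m) →
         ∃ λ (f : Fin m → Fin m → ℕ) → w2 c ≡ List.sum (map (λ x → List.sum (map (f x) (allFin m))) (allFin m))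
w2Term c = _ , refl

module Choice {m : ℕ} (c : TCM m) where

  -- A Boolean form of the contributions to the multiplicity, which turns multiplicities into
  -- cardinalities.
  picks : (x y : Fin m) → toℕ x < toℕ y → Subset m
  picks x y x<y z with <-cmp (toℕ z) (toℕ x)
  ... | tri< z<x _ _ = does (c z x y z<x x<y ≟ 2F)
  ... | tri≈ _ _ _   = false
  ... | tri> _ _ x<z with <-cmp (toℕ z) (toℕ y)
  ...   | tri< z<y _ _ = does (c x z y x<z z<y ≟ 1F)
  ...   | tri≈ _ _ _   = false
  ...   | tri> _ _ y<z = does (c x y z x<y y<z ≟ 0F)

  multTerm-picks : ∀ x y x<y z → proj₁ (multTerm c x y x<y) z ≡ ι (picks x y x<y z)
  multTerm-picks x y x<y z with <-cmp (toℕ z) (toℕ x)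
  multTerm-picks x y x<y z | tri< z<x _ _ with c z x y z<x x<y
  ... | 0F = refl
  ... | 1F = refl
  ... | 2F = refl
  multTerm-picks x y x<y z | tri≈ _ _ _ = refl
  multTerm-picks x y x<y z | tri> _ _ x<z with <-cmp (toℕ z) (toℕ y)
  multTerm-picks x y x<y z | tri> _ _ x<z | tri< z<y _ _ with c x z y x<z z<y
  ... | 0F = refl
  ... | 1F = refl
  ... | 2F = refl
  multTerm-picks x y x<y z | tri> _ _ x<z | tri≈ _ _ _ = refl
  multTerm-picks x y x<y z | tri> _ _ x<z | tri> _ _ y<z with c x y z x<y y<z
  ... | 0F = refl
  ... | 1F = refl
  ... | 2F = refl

  mult≡card : ∀ x y x<y → mult c x y x<y ≡ card (picks x y x<y)
  mult≡card x y x<y = trans (proj₂ (multTerm c x y x<y))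
    (trans (list-sum-allFin m _) (sum-cong-≗ (multTerm-picks x y x<y)))

  W : Fin m → Fin m → Subset m
  W x y with <-cmp (toℕ x) (toℕ y)
  ... | tri< x<y _ _ = picks x y x<y
  ... | tri≈ _ _ _   = λ _ → false
  ... | tri> _ _ y<x = picks y x y<x

  W-< : ∀ {x y} (x<y : toℕ x < toℕ y) → W x y ≡ picks x y x<y
  W-< {x} {y} x<y with <-cmp (toℕ x) (toℕ y)
  ... | tri< p _ _   = cong (picks x y) (<-irrelevant p x<y)
  ... | tri≈ x≮y _ _ = contradiction x<y x≮y
  ... | tri> x≮y _ _ = contradiction x<y x≮y

  W-> : ∀ {x y} (y<x : toℕ y < toℕ x) → W x y ≡ picks y x y<x
  W-> {x} {y} y<x with <-cmp (toℕ x) (toℕ y)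
  ... | tri< _ _ y≮x = contradiction y<x y≮x
  ... | tri≈ _ _ y≮x = contradiction y<x y≮x
  ... | tri> _ _ p   = cong (picks y x) (<-irrelevant p y<x)

  W-sym : ∀ x y z → W x y z ≡ W y x z
  W-sym x y z with <-cmp (toℕ x) (toℕ y)
  ... | tri< x<y _ _ = cong (λ S → S z) (sym (W-> x<y))
  ... | tri> _ _ y<x = cong (λ S → S z) (sym (W-< y<x))
  ... | tri≈ _ x≡y _ with refl ← toℕ-injective x≡y with <-cmp (toℕ x) (toℕ x)
  ...   | tri< _ x≢x _ = contradiction refl x≢x
  ...   | tri≈ _ _ _   = refl
  ...   | tri> _ x≢x _ = contradiction refl x≢x

  W-degenerate : ∀ x y → W x y y ≡ false
  W-degenerate x y with <-cmp (toℕ x) (toℕ y)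
  ... | tri≈ _ _ _ = refl
  ... | tri> _ _ y<x with <-cmp (toℕ y) (toℕ y)
  ...   | tri< _ y≢y _ = contradiction refl y≢y
  ...   | tri≈ _ _ _   = refl
  ...   | tri> _ y≢y _ = contradiction refl y≢y
  W-degenerate x y | tri< x<y _ _ with <-cmp (toℕ y) (toℕ x)
  ... | tri< _ _ x≮y = contradiction x<y x≮y
  ... | tri≈ _ _ _   = refl
  ... | tri> _ _ _ with <-cmp (toℕ y) (toℕ y)
  ...   | tri< _ y≢y _ = contradiction refl y≢y
  ...   | tri≈ _ _ _   = refl
  ...   | tri> _ y≢y _ = contradiction refl y≢y

  module _ {u v w : Fin m} (u<v : toℕ u < toℕ v) (v<w : toℕ v < toℕ w) where

    private u<w = <-trans u<v v<w

    W-uv : W u v w ≡ does (c u v w u<v v<w ≟ 0F)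
    W-uv rewrite W-< u<v with <-cmp (toℕ w) (toℕ u)
    ... | tri< _ _ u≮w = contradiction u<w u≮w
    ... | tri≈ _ _ u≮w = contradiction u<w u≮w
    ... | tri> _ _ _ with <-cmp (toℕ w) (toℕ v)
    ...   | tri< _ _ v≮w = contradiction v<w v≮w
    ...   | tri≈ _ _ v≮w = contradiction v<w v≮w
    ...   | tri> _ _ p rewrite <-irrelevant p v<w = refl

    W-uw : W u w v ≡ does (c u v w u<v v<w ≟ 1F)
    W-uw rewrite W-< u<w with <-cmp (toℕ v) (toℕ u)
    ... | tri< _ _ u≮v = contradiction u<v u≮v
    ... | tri≈ _ _ u≮v = contradiction u<v u≮v
    ... | tri> _ _ p with <-cmp (toℕ v) (toℕ w)
    ...   | tri< q _ _ rewrite <-irrelevant p u<v | <-irrelevant q v<w = refl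
    ...   | tri≈ v≮w _ _ = contradiction v<w v≮w
    ...   | tri> v≮w _ _ = contradiction v<w v≮w

    W-vw : W v w u ≡ does (c u v w u<v v<w ≟ 2F)
    W-vw rewrite W-< v<w with <-cmp (toℕ u) (toℕ v)
    ... | tri< p _ _ rewrite <-irrelevant p u<v = refl
    ... | tri≈ u≮v _ _ = contradiction u<v u≮v
    ... | tri> u≮v _ _ = contradiction u<v u≮v

  W-excl : ∀ {x y z} → y ≢ x → z ≢ x → y ≢ z → W x y z ≡ true → W x z y ≡ false
  W-excl {x} {y} {z} y≢x z≢x y≢z = excl (<-cmp (toℕ x) (toℕ y)) (<-cmp (toℕ x) (toℕ z)) (<-cmp (toℕ y) (toℕ z))
    where
    separate : ∀ {S T} (e a b : Fin 3) → a ≢ b → S ≡ does (e ≟ a) → T ≡ does (e ≟ b) → S ≡ true → T ≡ false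
    separate e a b a≢b refl refl p with yes refl ← e ≟ a = dec-false (e ≟ b) a≢b
    excl : Tri (toℕ x < toℕ y) (toℕ x ≡ toℕ y) (toℕ y < toℕ x) → Tri (toℕ x < toℕ z) (toℕ x ≡ toℕ z) (toℕ z < toℕ x) →
           Tri (toℕ y < toℕ z) (toℕ y ≡ toℕ z) (toℕ z < toℕ y) → W x y z ≡ true → W x z y ≡ false
    excl (tri≈ _ x≡y _) _ _ = contradiction (sym (toℕ-injective x≡y)) y≢x
    excl _ (tri≈ _ x≡z _) _ = contradiction (sym (toℕ-injective x≡z)) z≢x
    excl _ _ (tri≈ _ y≡z _) = contradiction (toℕ-injective y≡z) y≢z
    -- Two chained comparisons fix the order of the triple. The six clauses are the six orders, each
    -- sorted before the choice is read off.
    excl (tri< p _ _) _ (tri< q _ _) = separate (c x y z p q) 0F 1F (λ ()) (W-uv p q) (W-uw p q)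
    excl _ (tri< p _ _) (tri> _ _ q) = separate (c x z y p q) 1F 0F (λ ()) (W-uw p q) (W-uv p q)
    excl (tri> _ _ p) (tri< q _ _) _ = separate (c y x z p q) 0F 2F (λ ()) (trans (W-sym x y z) (W-uv p q)) (W-vw p q)
    excl (tri< q _ _) (tri> _ _ p) _ = separate (c z x y p q) 2F 0F (λ ()) (W-vw p q) (trans (W-sym x z y) (W-uv p q))
    excl _ (tri> _ _ q) (tri< p _ _) = separate (c y z x p q) 1F 2F (λ ()) (trans (W-sym x y z) (W-uw p q)) (trans (W-sym x z y) (W-vw p q))
    excl (tri> _ _ q) _ (tri> _ _ p) = separate (c z y x p q) 2F 1F (λ ()) (trans (W-sym x y z) (W-vw p q)) (trans (W-sym x z y) (W-uw p q))

  -- Each pair is counted in `w2` only in increasing order, and the other entries vanish;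
  -- symmetrising counts it in both orders.
  2*w2 : 2 * w2 c ≡ ∑≢ (λ x y → 2 ^ card (W x y))
  2*w2 = begin
    2 * w2 c                                ≡⟨ cong (2 *_) (proj₂ (w2Term c)) ⟩
    2 * List.sum (map (λ x → List.sum (map (t x) (allFin m))) (allFin m))
      ≡⟨ cong (2 *_) (trans (list-sum-allFin m _) (sum-cong-≗ (λ x → list-sum-allFin m (t x)))) ⟩
    2 * sum (λ x → sum (t x))               ≡⟨ cong (2 *_) (sum-cong-≗ (λ x → sum-cong-≗ (t-diagonal x))) ⟩
    2 * ∑≢ t                                ≡⟨ ∑≢-symmetrise t ⟨
    ∑≢ (λ x y → t x y + t y x)              ≡⟨ ∑≢-cong t-pair ⟩
    ∑≢ (λ x y → 2 ^ card (W x y))           ∎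
    where
    open ≡-Reasoning
    t : Fin m → Fin m → ℕ
    t = proj₁ (w2Term c)
    t-< : ∀ {x y} (x<y : toℕ x < toℕ y) → t x y ≡ 2 ^ mult c x y x<y
    t-< {x} {y} x<y with <-cmp (toℕ x) (toℕ y)
    ... | tri< p _ _   = cong (λ q → 2 ^ mult c x y q) (<-irrelevant p x<y)
    ... | tri≈ x≮y _ _ = contradiction x<y x≮y
    ... | tri> x≮y _ _ = contradiction x<y x≮y
    t-≮ : ∀ {x y} → ¬ toℕ x < toℕ y → t x y ≡ 0
    t-≮ {x} {y} x≮y with <-cmp (toℕ x) (toℕ y)
    ... | tri< p _ _ = contradiction p x≮y
    ... | tri≈ _ _ _ = refl
    ... | tri> _ _ _ = refl
    t-diagonal : ∀ x y → t x y ≡ (if does (y ≟ x) then 0 else t x y)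
    t-diagonal x y with y ≟ x
    ... | yes refl = t-≮ {x} {x} (<-irrefl refl)
    ... | no _     = refl
    t-pair : ∀ {x y} → y ≢ x → t x y + t y x ≡ 2 ^ card (W x y)
    t-pair {x} {y} y≢x = order (<-cmp (toℕ x) (toℕ y))
      where
      order : Tri (toℕ x < toℕ y) (toℕ x ≡ toℕ y) (toℕ y < toℕ x) → t x y + t y x ≡ 2 ^ card (W x y)
      order (tri≈ _ x≡y _)     = contradiction (sym (toℕ-injective x≡y)) y≢x
      order (tri< x<y _ y≮x) = trans (cong₂ _+_ (t-< x<y) (t-≮ {y} {x} y≮x)) (trans (+-identityʳ _)
        (cong (2 ^_) (trans (mult≡card x y x<y) (cong card (sym (W-< x<y))))))
      order (tri> x≮y _ y<x) = trans (cong₂ _+_ (t-≮ {x} {y} x≮y) (t-< y<x))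
        (cong (2 ^_) (trans (mult≡card y x y<x) (cong card (sym (W-> y<x)))))

-- The bound for every TCM bounds the maximum. Denominators are cleared by `384 = 192 * 2`, where
-- the 2 turns the exponent `m - 1` into `m` and so covers `m = 0`.
theorem1p6 : (m : ℕ) → (G : TCM m) → 384 * w2 G ≤ 83 * m * 2 ^ m
theorem1p6 m G = begin
  384 * w2 G                                ≡⟨ *-assoc 192 2 (w2 G) ⟩
  192 * (2 * w2 G)                          ≡⟨ cong (192 *_) 2*w2 ⟩
  192 * ∑≢ (λ x y → 2 ^ card (W x y))       ≤⟨ pair-sum-bound ⟩
  83 * m * 2 ^ m                            ∎
  where
  open ≤-Reasoning
  open Choice G
  open Averaging W W-sym W-excl W-degenerate
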